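{- Let $k\ge2$, $n\geq 1$ and let $p_1,\ldots,p_k$ be positive integers. There is a bijection $\Phi$ between the set $\mathcal{C}^n_{p_1,\ldots,p_k}$ of $(p_1,\ldots,p_k)$-colored rooted $k$-cacti of size $n$ and the set $\mathcal{T}^n_{p_1,\ldots,p_k}$ of vertex-labelled tree-rooted $k$-constellations of size $n$ and type $(p_1,\ldots,p_k)$. Moreover, $\Phi$ has the following degree preserving property: for any $C\in\mathcal{C}^n_{p_1,\ldots,p_k}$, any $t\in[k]$, any $i\in[p_t]$ and any $j\in[p_{t+1}]$, the number of edges joining vertices of type $t$ and color $i$ to vertices of type $t+1$ and color $j$ in $C$ is equal to the number of edges joining the vertex of type $t$ labelled $i$ to the vertex of type $t+1$ labelled $j$ in the tree-rooted constellation $\Phi(C)$ (types are taken modulo $k$).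
   Context: $[m]=\{1,\ldots,m\}$. A map is a cellular embedding (all faces simply connected) of a connected graph (loops and multiple edges allowed) in an oriented compact connected surface without boundary, considered up to orientation preserving homeomorphism. A $k$-constellation is a map with black and white faces and with vertices of types $1,\ldots,k$ (types taken modulo $k$) such that (i) each edge separates a black face and a white face, and (ii) each black face has degree $k$ and is incident to vertices of type $1,2,\ldots,k$ in this order clockwise around the face. Black faces are called hyperedges; the size is the number of hyperedges. An edge has type $t\in[k]$ if, clockwise around its incident hyperedge, it goes from a vertex of type $t$ to a vertex of type $t+1$; thus each hyperedge is incident to exactly one vertex and one edge of each type. Standard combinatorial encoding: $k$-constellations with hyperedges labelled by $[n]$ correspond bijectively to tuples $(\pi_1,\ldots,\pi_k)$ of permutations of $[n]$ generating a transitive group, the cycles of $\pi_t$ being the counterclockwise orders of the hyperedges around the vertices of type $t$; the white faces correspond to the cycles of $\pi_1\pi_2\cdots\pi_k$. A constellation is rooted if one hyperedge is distinguished (root hyperedge); its root vertex is the vertex of type $k$ incident to the root hyperedge. A $k$-cactus is a $k$-constellation with a single white face. A $(p_1,\ldots,p_k)$-colored cactus is a $k$-cactus whose vertices of type $t$ are colored with colors in $[p_t]$, every color in $[p_t]$ being used, for every $t\in[k]$. A constellation has type $(p_1,\ldots,p_k)$ if it has $p_t$ vertices of type $t$ for all $t$; it is vertex-labelled if for each $t$ its $p_t$ vertices of type $t$ have distinct labels in $[p_t]$. For a vertex $v_0$ of a constellation $C$, a $v_0$-arborescence of $C$ is a spanning tree $A$ of (the underlying graph of) $C$ such that every vertex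 $v\ne v_0$ of type $t$ is incident to exactly one edge of type $t$ in $A$. A tree-rooted constellation is a pair $(C,A)$ where $C$ is a rooted constellation and $A$ is a $v_0$-arborescence of $C$, with $v_0$ the root vertex of $C$. -}

module Defs where

open import Data.Bool.Base using (Bool; T)
open import Data.Fin.Base using (Fin; toℕ; fromℕ)
open import Data.Fin.Permutation as Perm
  using (Permutation′; _⟨$⟩ʳ_; _⟨$⟩ˡ_; _∘ₚ_)
import Data.Fin.Properties as Fin
open import Data.List.Base
  using (List; []; _∷_; length; filter; allFin; cartesianProduct)
open import Data.List.Relation.Unary.Unique.Propositional
  using () renaming (Unique to Unique-≡)
import Data.List.Relation.Unary.Unique.Setoid as UniqueSetoid
open import Data.Nat.Base using (ℕ; suc; NonTrivial)
open import Data.Nat.DivMod using (_mod_)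
open import Data.Product using (Σ; ∃; ∃!; _×_; _,_; proj₁; proj₂)
open import Data.Product.Properties using (≡-dec)
open import Data.Sum.Base using (_⊎_)
open import Data.Vec.Functional using (foldr)
open import Function.Bundles using (Surjection; Bijection)
open import Level using (0ℓ)
open import Relation.Binary.Bundles using (Setoid)
open import Relation.Binary.Construct.Closure.Equivalence as EqC
  using (EqClosure)
open import Relation.Binary.PropositionalEquality
  using (_≡_; _≢_; refl; sym; trans; cong; setoid)
open import Relation.Nullary.Decidable using (Dec; _×-dec_; _⊎-dec_)
open import Relation.Nullary.Negation using (¬_)

------------------------------------------------------------------------
-- Multigraphs (undirected; loops and multiple edges allowed)

-- `source` and `target` merely name the two ends of an edge.

record Graph : Set₁ where
  field
    vertices      : Setoid 0ℓ 0ℓ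
    Edge          : Set
    source target : Edge → Setoid.Carrier vertices

  open Setoid vertices public
    using () renaming (Carrier to Vertex; _≈_ to _≈ᵥ_)

  Joins : Edge → Vertex → Vertex → Set
  Joins e u v = (source e ≈ᵥ u × target e ≈ᵥ v)
              ⊎ (source e ≈ᵥ v × target e ≈ᵥ u)

  Incident : Edge → Vertex → Set
  Incident e v = source e ≈ᵥ v ⊎ target e ≈ᵥ v

  EdgeSet : Set
  EdgeSet = Edge → Bool

  data Walk (A : EdgeSet) : Vertex → Vertex → Set where
    stop : ∀ {u v} → u ≈ᵥ v → Walk A u v
    step : ∀ {u v w} (e : Edge) → T (A e) → Joins e u v → Walk A v w →
           Walk A u w

  walkEdges : ∀ {A u v} → Walk A u v → List Edge
  walkEdges (stop _)       = []
  walkEdges (step e _ _ w) = e ∷ walkEdges w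

  -- All the vertices visited, except for the final one.

  walkVertices : ∀ {A u v} → Walk A u v → List Vertex
  walkVertices (stop _)               = []
  walkVertices (step {u = u} _ _ _ w) = u ∷ walkVertices w

  -- Cycles of length 1 (loops) and 2 (pairs of parallel edges) count;
  -- traversing one edge back and forth does not.

  IsCycle : ∀ {A v} → Walk A v v → Set
  IsCycle w = walkEdges w ≢ []
            × Unique-≡ (walkEdges w)
            × UniqueSetoid.Unique vertices (walkVertices w)

  -- The subgraph containing every vertex and exactly the edges in A is
  -- connected and acyclic.

  record IsSpanningTree (A : EdgeSet) : Set where
    field
      connected : ∀ u v → Walk A u v
      acyclic   : ∀ {v} (w : Walk A v v) → ¬ IsCycle w

------------------------------------------------------------------------
-- Types of vertices and edges: t ∈ [k] is the element of Fin k with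
-- toℕ equal to t - 1.

nextType : ∀ {k} → Fin k → Fin k
nextType {suc k} t = suc (toℕ t) mod suc k

-- The type k.

lastType : ∀ {k} .{{_ : NonTrivial k}} → Fin k
lastType {suc k} = fromℕ k

------------------------------------------------------------------------
-- Constellations

-- The set of (supports of) cycles of a permutation.

cycles : ∀ {n} → Permutation′ n → Setoid 0ℓ 0ℓ
cycles π = EqC.setoid (λ x y → π ⟨$⟩ʳ x ≡ y)

-- π₁π₂⋯πₖ, composed as functions: πₖ is applied first.  This is the
-- order for which the cycles are the white faces when πₜ turns
-- counterclockwise around the vertices of type t and the types increase
-- clockwise around hyperedges.  (_∘ₚ_ applies its left argument first.)

product : ∀ {k n} → (Fin k → Permutation′ n) → Permutation′ n
product = foldr (λ π ρ → ρ ∘ₚ π) Perm.id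

-- A k-constellation with hyperedges labelled by Fin n: π t h is the
-- hyperedge following h counterclockwise around the vertex of type t
-- incident to h.  Transitivity: the equivalence closure of "some π t
-- maps x to y" is the orbit relation of the group generated by the π t.

record Constellation (k n : ℕ) : Set where
  field
    π          : Fin k → Permutation′ n
    transitive : ∀ x y → EqClosure (λ x y → ∃ λ t → π t ⟨$⟩ʳ x ≡ y) x y

  verticesOfType : Fin k → Setoid 0ℓ 0ℓ
  verticesOfType t = cycles (π t)

  whiteFaces : Setoid 0ℓ 0ℓ
  whiteFaces = cycles (product π)

  -- The pair (t , h) represents the vertex of type t incident to the
  -- hyperedge h.

  vertices : Setoid 0ℓ 0ℓ
  vertices = record
    { Carrier       = Fin k × Fin n
    ; _≈_           = λ (t , x) (s , y) →
                        t ≡ s × Setoid._≈_ (verticesOfType t) x y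
    ; isEquivalence = record
      { refl  = λ {(t , _)} → refl , Setoid.refl (verticesOfType t)
      ; sym   = λ { {t , _} (refl , p) →
                  refl , Setoid.sym (verticesOfType t) p }
      ; trans = λ { {t , _} (refl , p) (refl , q) →
                  refl , Setoid.trans (verticesOfType t) p q }
      }
    }

  -- The pair (t , h) is the edge of type t of the hyperedge h.

  graph : Graph
  graph = record
    { vertices = vertices
    ; Edge     = Fin k × Fin n
    ; source   = λ (t , h) → t , h
    ; target   = λ (t , h) → nextType t , h
    }

  open Graph graph public hiding (vertices)

  HasSingleWhiteFace : Set
  HasSingleWhiteFace =
    ∃ λ (f : Fin n) → ∀ g → Setoid._≈_ whiteFaces f g

  record IsArborescence (v₀ : Vertex) (A : EdgeSet) : Set where
    field
      isSpanningTree : IsSpanningTree A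
      uniqueEdge     : ∀ v → ¬ (v ≈ᵥ v₀) →
                       ∃! _≡_ λ e →
                         T (A e) × proj₁ e ≡ proj₁ v × Incident e v

record RootedConstellation (k n : ℕ) : Set where
  field
    constellation : Constellation k n
    root          : Fin n

  open Constellation constellation public

  rootVertex : .{{_ : NonTrivial k}} → Vertex
  rootVertex = lastType , root

-- Constellations of size n with unlabelled hyperedges are labelled ones
-- up to relabelling of the hyperedges.

record _≅_ {k n} (C D : RootedConstellation k n) : Set where
  private
    module C = RootedConstellation C
    module D = RootedConstellation D
  field
    relabel : Permutation′ n
    π-comm  : ∀ t h → relabel ⟨$⟩ʳ (C.π t ⟨$⟩ʳ h) ≡
                      D.π t ⟨$⟩ʳ (relabel ⟨$⟩ʳ h)
    root-eq : relabel ⟨$⟩ʳ C.root ≡ D.root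

open _≅_ public using (relabel)

module _ {k n : ℕ} where

  ≅-refl : {C : RootedConstellation k n} → C ≅ C
  ≅-refl = record
    { relabel = Perm.id ; π-comm = λ _ _ → refl ; root-eq = refl }

  ≅-sym : {C D : RootedConstellation k n} → C ≅ D → D ≅ C
  ≅-sym {C} {D} i = record
    { relabel = Perm.flip σ
    ; π-comm  = λ t h → trans
        (cong (σ ⟨$⟩ˡ_) (trans
          (cong (D.π t ⟨$⟩ʳ_) (sym (Perm.inverseʳ σ)))
          (sym (_≅_.π-comm i t (σ ⟨$⟩ˡ h)))))
        (Perm.inverseˡ σ)
    ; root-eq = trans (cong (σ ⟨$⟩ˡ_) (sym (_≅_.root-eq i)))
                      (Perm.inverseˡ σ)
    }
    where
    σ = relabel i
    module D = RootedConstellation D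

  ≅-trans : {C D E : RootedConstellation k n} → C ≅ D → D ≅ E → C ≅ E
  ≅-trans i j = record
    { relabel = relabel i ∘ₚ relabel j
    ; π-comm  = λ t h → trans
        (cong (relabel j ⟨$⟩ʳ_) (_≅_.π-comm i t h))
        (_≅_.π-comm j t (relabel i ⟨$⟩ʳ h))
    ; root-eq = trans (cong (relabel j ⟨$⟩ʳ_) (_≅_.root-eq i))
                      (_≅_.root-eq j)
    }

------------------------------------------------------------------------
-- Counting edges by the colors (or labels) of their ends

-- c t h is the color of the vertex of type t incident to h.

module _ {k : ℕ} (n : ℕ) {p : Fin k → ℕ} (c : ∀ t → Fin n → Fin (p t)) where

  private
    TypedColor : Set
    TypedColor = Σ (Fin k) λ t → Fin (p t)

    _≟_ : (x y : TypedColor) → Dec (x ≡ y)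
    _≟_ = ≡-dec Fin._≟_ Fin._≟_

    sourceColor targetColor : Fin k × Fin n → TypedColor
    sourceColor (t , h) = t , c t h
    targetColor (t , h) = nextType t , c (nextType t) h

  JoinsColors : TypedColor → TypedColor → Fin k × Fin n → Set
  JoinsColors x y e = (sourceColor e ≡ x × targetColor e ≡ y)
                    ⊎ (sourceColor e ≡ y × targetColor e ≡ x)

  joinsColors? : ∀ x y e → Dec (JoinsColors x y e)
  joinsColors? x y e = ((sourceColor e ≟ x) ×-dec (targetColor e ≟ y))
                 ⊎-dec ((sourceColor e ≟ y) ×-dec (targetColor e ≟ x))

  -- For k = 2 this includes edges of both types, since edges of type 2
  -- also join vertices of types 1 and 2.

  edgeCount : ∀ t → Fin (p t) → Fin (p (nextType t)) → ℕ
  edgeCount t i j =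
    length (filter (joinsColors? (t , i) (nextType t , j))
                   (cartesianProduct (allFin k) (allFin n)))

------------------------------------------------------------------------
-- Colored rooted cacti

record ColoredCactus {k} (n : ℕ) (p : Fin k → ℕ) : Set where
  field
    rooted : RootedConstellation k n

  open RootedConstellation rooted public

  field
    singleWhiteFace : HasSingleWhiteFace
    coloring        : ∀ t → Surjection (verticesOfType t)
                                       (setoid (Fin (p t)))

  color : ∀ t → Fin n → Fin (p t)
  color t = Surjection.to (coloring t)

  edgesJoining : ∀ t → Fin (p t) → Fin (p (nextType t)) → ℕ
  edgesJoining = edgeCount n color

coloredCacti : ∀ {k} (n : ℕ) (p : Fin k → ℕ) → Setoid 0ℓ 0ℓ
coloredCacti n p = record
  { Carrier       = ColoredCactus n p
  ; _≈_           = λ C D → Σ (rooted C ≅ rooted D) λ i →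
                      ∀ t h → color C t h ≡ color D t (relabel i ⟨$⟩ʳ h)
  ; isEquivalence = record
    { refl  = ≅-refl , λ _ _ → refl
    ; sym   = λ {_} {D} (i , eq) → ≅-sym i , λ t h →
                trans (cong (color D t) (sym (Perm.inverseʳ (relabel i))))
                      (sym (eq t (relabel i ⟨$⟩ˡ h)))
    ; trans = λ (i , eq) (j , eq′) → ≅-trans i j , λ t h →
                trans (eq t h) (eq′ t (relabel i ⟨$⟩ʳ h))
    }
  }
  where open ColoredCactus

------------------------------------------------------------------------
-- Vertex-labelled tree-rooted constellations

-- The bijections `labelling` say both that the type is p and that the
-- vertices of each type are distinctly labelled.

record TreeRooted {k} .{{_ : NonTrivial k}} (n : ℕ) (p : Fin k → ℕ) : Set
  where
  field
    rooted : RootedConstellation k n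

  open RootedConstellation rooted public

  field
    tree           : EdgeSet
    isArborescence : IsArborescence rootVertex tree
    labelling      : ∀ t → Bijection (verticesOfType t)
                                     (setoid (Fin (p t)))

  label : ∀ t → Fin n → Fin (p t)
  label t = Bijection.to (labelling t)

  edgesJoining : ∀ t → Fin (p t) → Fin (p (nextType t)) → ℕ
  edgesJoining = edgeCount n label

treeRootedConstellations : ∀ {k} .{{_ : NonTrivial k}}
                           (n : ℕ) (p : Fin k → ℕ) → Setoid 0ℓ 0ℓ
treeRootedConstellations n p = record
  { Carrier       = TreeRooted n p
  ; _≈_           = λ C D → Σ (rooted C ≅ rooted D) λ i →
                      (∀ t h → label C t h ≡ label D t (relabel i ⟨$⟩ʳ h))
                    × (∀ t h → tree C (t , h) ≡
                               tree D (t , relabel i ⟨$⟩ʳ h))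
  ; isEquivalence = record
    { refl  = ≅-refl , (λ _ _ → refl) , (λ _ _ → refl)
    ; sym   = λ {_} {D} (i , eqˡ , eqᵗ) → ≅-sym i
            , (λ t h →
                trans (cong (label D t) (sym (Perm.inverseʳ (relabel i))))
                      (sym (eqˡ t (relabel i ⟨$⟩ˡ h))))
            , (λ t h →
                trans (cong (λ h → tree D (t , h))
                            (sym (Perm.inverseʳ (relabel i))))
                      (sym (eqᵗ t (relabel i ⟨$⟩ˡ h))))
    ; trans = λ (i , eqˡ , eqᵗ) (j , eqˡ′ , eqᵗ′) → ≅-trans i j
            , (λ t h → trans (eqˡ t h) (eqˡ′ t (relabel i ⟨$⟩ʳ h)))
            , (λ t h → trans (eqᵗ t h) (eqᵗ′ t (relabel i ⟨$⟩ʳ h)))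
    }
  }
  where open TreeRooted

{-# OPTIONS --safe #-}

-- Glue the vertices of equal color in a cactus.  Since there is a single white
-- face, its boundary becomes an Eulerian tour of the glued digraph, whose arcs
-- are the edges of type t directed from type t to type t + 1.  As in the BEST
-- theorem, such a tour amounts to a cyclic order of the arcs leaving each
-- vertex (the order in which the tour uses them) together with the arborescence
-- formed by the last exits from all vertices but the root.  Each arc leaving a
-- vertex belongs to exactly one hyperedge, so the cyclic orders are the rotation
-- system of a constellation whose vertices are the colors (they are read
-- backwards here).  Conversely, the tour is the walk which always leaves a vertex
-- by the next arc in its cyclic order, starting with the one after the tree arc.
module Submission where

open import Defs
open import Data.Bool.Base using (Bool; T)
open import Data.Bool.Properties using (T?)
open import Data.Fin.Base using (Fin; zero; suc; toℕ; fromℕ; combine)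
open import Data.Fin.Permutation as Perm using (Permutation′; _⟨$⟩ʳ_; _⟨$⟩ˡ_)
import Data.Fin.Properties as Fin
open import Data.List.Base using ([]; _∷_; applyUpTo)
open import Data.List.Membership.Propositional using (_∈_)
open import Data.List.Relation.Unary.All using (All; []; _∷_; lookup)
open import Data.List.Relation.Unary.AllPairs using ([]; _∷_)
open import Data.List.Relation.Unary.Any using (here; there)
open import Data.List.Relation.Unary.Unique.Propositional using (Unique)
import Data.List.Relation.Unary.Unique.Propositional.Properties as Unique
import Data.List.Relation.Unary.Unique.Setoid as UniqueSetoid
import Data.List.Relation.Unary.Unique.Setoid.Properties as UniqueSetoid
open import Data.Nat.Base using (ℕ; zero; suc; 2+; pred; _+_; _*_; _∸_;
  _<_; _≤_; z≤n; s≤s; s≤s⁻¹; NonZero; NonTrivial; >-nonZero)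
open import Data.Nat.DivMod
open import Data.Nat.GeneralisedArithmetic using (iterate)
open import Data.Nat.Properties hiding (_≟_)
open import Data.Product using (Σ; Σ-syntax; ∃; ∃₂; _×_; _,_; proj₁; proj₂)
open import Data.Product.Properties using (≡-dec; ,-injectiveˡ; ,-injectiveʳ)
open import Data.Sum.Base using (_⊎_; inj₁; inj₂; swap)
open import Function.Base using (_∘_)
open import Function.Bundles using (Bijection; Surjection; mk⇔)
open import Function.Definitions using (Injective; Surjective)
open import Relation.Binary.Bundles using (Setoid)
open import Relation.Binary.Construct.Closure.Equivalence as EqC using (EqClosure)
open import Relation.Binary.Definitions using (DecidableEquality; tri<; tri≈; tri>)
open import Relation.Binary.PropositionalEquality
open import Relation.Nullary.Decidable using (Dec; yes; no; ¬?; _×-dec_; ⌊_⌋;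
  toWitness; fromWitness; decidable-stable; isYes≗does; does-⇔)
open import Relation.Nullary.Negation using (¬_; contradiction)

-- Finite sets and tours

-- The arborescence has no arc leaving the root vertex; the root hyperedge makes up for it. The tour
-- is cut at the edge of type k of the root hyperedge, and the last exit from the root vertex before
-- that edge is its predecessor in the cyclic order. So rotation system, tree and root together give
-- a last exit at every vertex.
--
-- The delicate point is that the walk prescribed by a tree-rooted constellation uses every edge.
-- The reason is balance: a hyperedge contributes to each of its vertices one arc in and one arc
-- out, paired by `along`. Stopped at its first repeated arc, the walk is therefore at the root
-- vertex with all arcs there used; as the tree arc of a vertex is used last, exhaustion then
-- spreads from every vertex to its children in the tree.
--
-- Vertices of a constellation are cycles, with a closure relation as equality. Tours need decidable
-- vertices, so they live on pairs of a type and a color.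

iterate-+ : ∀ {A : Set} (f : A → A) x m n → iterate f x (m + n) ≡ iterate f (iterate f x m) n
iterate-+ f x zero    n = refl
iterate-+ f x (suc m) n = iterate-+ f (f x) m n

iterate-suc : ∀ {A : Set} (f : A → A) x n → iterate f x (suc n) ≡ f (iterate f x n)
iterate-suc f x zero    = refl
iterate-suc f x (suc n) = iterate-suc f (f x) n

iterate-injective : ∀ {A : Set} {f : A → A} → Injective _≡_ _≡_ f →
                    ∀ n {x y} → iterate f x n ≡ iterate f y n → x ≡ y
iterate-injective inj zero    eq = eq
iterate-injective inj (suc n) eq = inj (iterate-injective inj n eq)

InjectiveBelow : ∀ {A : Set} → (ℕ → A) → ℕ → Set
InjectiveBelow f m = ∀ {a b} → a < b → b < m → f a ≢ f b

module FiniteSet {A : Set} (_≟_ : DecidableEquality A)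
                 {N : ℕ} (code : A → Fin N) (code-injective : Injective _≡_ _≡_ code)
                 where

  FirstRepeat : (ℕ → A) → Set
  FirstRepeat f = ∃₂ λ j m → j < m × f j ≡ f m × InjectiveBelow f m

  abstract
    private
      scan : ∀ (f : ℕ → A) m → InjectiveBelow f m ⊎ FirstRepeat f
      scan f zero = inj₁ λ _ ()
      scan f (suc m) with scan f m
      ... | inj₂ repeat = inj₂ repeat
      ... | inj₁ distinct with anyUpTo? (λ j → f j ≟ f m) m
      ...   | yes (j , j<m , eq) = inj₂ (j , m , j<m , eq , distinct)
      ...   | no fresh = inj₁ extend
        where
        extend : InjectiveBelow f (suc m)
        extend {a} {b} a<b b<1+m with m≤n⇒m<n∨m≡n (s≤s⁻¹ b<1+m)
        ... | inj₁ b<m  = distinct a<b b<m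
        ... | inj₂ refl = λ eq → fresh (a , a<b , eq)

    firstRepeat : ∀ f → FirstRepeat f
    firstRepeat f with scan f (suc N)
    ... | inj₂ repeat = repeat
    ... | inj₁ distinct
        with i , j , i<j , eq ← Fin.pigeonhole (n<1+n N) (code ∘ f ∘ toℕ)
        = contradiction (code-injective eq) (distinct i<j (Fin.toℕ<n j))

  module _ {f : A → A} (f-injective : Injective _≡_ _≡_ f) where

    abstract
      period : ∀ x → ∃ λ m → iterate f x (suc m) ≡ x
      period x with j , m , j<m , eq , _ ← firstRepeat (iterate f x)
               with d , refl ← m≤n⇒∃[o]m+o≡n j<m
               = d , sym (iterate-injective f-injective j (begin
                   iterate f x j                       ≡⟨ eq ⟩
                   iterate f x (suc j + d)             ≡⟨ cong (iterate f x ∘ suc) (+-comm j d) ⟩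
                   iterate f x (suc d + j)             ≡⟨ iterate-+ f x (suc d) j ⟩
                   iterate f (iterate f x (suc d)) j   ∎))
        where open ≡-Reasoning

      injective⇒surjective : ∀ y → ∃ λ x → f x ≡ y
      injective⇒surjective y with d , eq ← period y =
        iterate f y d , trans (sym (iterate-suc f y d)) eq

    abstract
      inverse : A → A
      inverse = proj₁ ∘ injective⇒surjective

      f∘inverse : ∀ y → f (inverse y) ≡ y
      f∘inverse = proj₂ ∘ injective⇒surjective

    inverse∘f : ∀ x → inverse (f x) ≡ x
    inverse∘f x = f-injective (f∘inverse (f x))

    -- Going back one step is going forward the rest of the cycle, whose length `period` provides.
    -- Hence forward iteration alone exhausts the equivalence closure.
    iterate-sym : ∀ m {x y} → iterate f x m ≡ y → ∃ λ m′ → iterate f y m′ ≡ x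
    iterate-sym zero    eq = 0 , sym eq
    iterate-sym (suc m) {x} eq with iterate-sym m eq
    ... | m′ , eq′ with d , per ← period x = m′ + d ,
          trans (iterate-+ f _ m′ d) (trans (cong (λ z → iterate f z d) eq′) per)

    closure⇒iterate : ∀ {x y} → EqClosure (λ x y → f x ≡ y) x y → ∃ λ m → iterate f x m ≡ y
    closure⇒iterate = EqC.fold
      (record
        { refl  = 0 , refl
        ; sym   = λ (m , eq) → iterate-sym m eq
        ; trans = λ {x} (m , eq) (m′ , eq′) → m + m′ ,
            trans (iterate-+ f x m m′) (trans (cong (λ z → iterate f z m′) eq) eq′)
        })
      (λ eq → 1 , eq)

-- The condition `v ≢ w` stops a path at its first visit to `w`, so all paths from `v` have the same
-- length; `rank-unique` depends on this.
data Reaches {V : Set} (parent : V → V) (w : V) : V → Set where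
  arrived : Reaches parent w w
  climb   : ∀ {v} → v ≢ w → Reaches parent w (parent v) → Reaches parent w v

Reaches-cong : ∀ {V : Set} {f g : V → V} {w v} → f ≗ g → Reaches f w v → Reaches g w v
Reaches-cong f≗g arrived              = arrived
Reaches-cong f≗g (climb {v = v} v≢ r) =
  climb v≢ (subst (Reaches _ _) (f≗g v) (Reaches-cong f≗g r))

-- Closed tours and their last exits

record Tour (E V : Set) : Set where
  field
    source : E → V
    τ κ    : E → E
    τ∘κ    : ∀ x → τ (κ x) ≡ x
    κ∘τ    : ∀ x → κ (τ x) ≡ x
    root   : E
    -- Starting at `κ z` keeps the search for a last exit strictly before `z`, and still finds `z`
    -- itself after a full turn.
    orbit  : ∀ z x → ∃ λ m → iterate κ (κ z) m ≡ x
    arc    : V → E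
    source-arc : ∀ v → source (arc v) ≡ v

module Exits {E V : Set} (_≟_ : DecidableEquality V) (W : Tour E V) where
  open Tour W

  -- LastExit z v y: among the arcs leaving v, y is the last one that the
  -- tour uses strictly before it uses z.
  data LastExit (z : E) (v : V) : E → Set where
    here  : source (κ z) ≡ v → LastExit z v (κ z)
    there : ∀ {y} → source (κ z) ≢ v → LastExit (κ z) v y → LastExit z v y

  LastExit-unique : ∀ {z v y y′} → LastExit z v y → LastExit z v y′ → y ≡ y′
  LastExit-unique (here _)    (here _)     = refl
  LastExit-unique (here p)    (there ¬p _) = contradiction p ¬p
  LastExit-unique (there ¬p _) (here p)    = contradiction p ¬p
  LastExit-unique (there _ l) (there _ l′) = LastExit-unique l l′

  LastExit-exists : ∀ m z v → source (iterate κ (κ z) m) ≡ v → ∃ (LastExit z v)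
  LastExit-exists m z v eq with source (κ z) ≟ v
  LastExit-exists m       z v eq | yes p = κ z , here p
  LastExit-exists zero    z v eq | no ¬p = contradiction eq ¬p
  LastExit-exists (suc m) z v eq | no ¬p with y , l ← LastExit-exists m (κ z) v eq = y , there ¬p l

  abstract
    lastExit-∃ : ∀ z v → ∃ (LastExit z v)
    lastExit-∃ z v with m , eq ← orbit z (arc v) =
      LastExit-exists m z v (trans (cong source eq) (source-arc v))

  lastExit : E → V → E
  lastExit z v = proj₁ (lastExit-∃ z v)

  lastExit-spec : ∀ z v → LastExit z v (lastExit z v)
  lastExit-spec z v = proj₂ (lastExit-∃ z v)

  LastExit⇒lastExit : ∀ {z v y} → LastExit z v y → lastExit z v ≡ y
  LastExit⇒lastExit = LastExit-unique (lastExit-spec _ _)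

  lastExit-here : ∀ z → lastExit (τ z) (source z) ≡ z
  lastExit-here z = trans (LastExit⇒lastExit (here (cong source (κ∘τ z)))) (κ∘τ z)

  lastExit-κ : ∀ {z v} → source (κ z) ≢ v → lastExit z v ≡ lastExit (κ z) v
  lastExit-κ ¬p = LastExit⇒lastExit (there ¬p (lastExit-spec _ _))

  lastExit-there : ∀ {z v} → source z ≢ v → lastExit (τ z) v ≡ lastExit z v
  lastExit-there {z} {v} ¬p =
    trans (lastExit-κ (¬p ∘ trans (sym (cong source (κ∘τ z)))))
          (cong (λ z → lastExit z v) (κ∘τ z))

  LastExit-source : ∀ {z v y} → LastExit z v y → source y ≡ v
  LastExit-source (here p)    = p
  LastExit-source (there _ l) = LastExit-source l

  source-lastExit : ∀ z v → source (lastExit z v) ≡ v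
  source-lastExit z v = LastExit-source (lastExit-spec z v)

  -- The cyclic order at a vertex, read backwards. An arc that is alone in leaving its vertex is its
  -- own predecessor.
  previous : E → E
  previous z = lastExit z (source z)

  source-previous : ∀ z → source (previous z) ≡ source z
  source-previous z = source-lastExit z (source z)

  -- The relation read from its other end: after `y` the tour does not leave `v` again before it
  -- reaches `z`.
  LastExit-forward : ∀ {z v y} → LastExit z v y →
    ∃ λ d → z ≡ iterate τ (τ y) d × (∀ {i} → i < d → source (iterate τ (τ y) i) ≢ v)
  LastExit-forward (here _) = 0 , sym (τ∘κ _) , λ ()
  LastExit-forward {z} {v} {y} (there ¬p l) with LastExit-forward l
  ... | d , eq , away = suc d , z≡ , away′
    where
    z≡ : z ≡ iterate τ (τ y) (suc d)
    z≡ = trans (sym (τ∘κ z)) (trans (cong τ eq) (sym (iterate-suc τ (τ y) d)))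
    away′ : ∀ {i} → i < suc d → source (iterate τ (τ y) i) ≢ v
    away′ i<1+d with m≤n⇒m<n∨m≡n (s≤s⁻¹ i<1+d)
    ... | inj₁ i<d  = away i<d
    ... | inj₂ refl = ¬p ∘ trans (cong source eq)

  -- Going forward from the common predecessor, both `x` and `y` are the first arc to leave the same
  -- vertex. If one came earlier, it would be among the arcs avoiding that vertex on the way to the
  -- other.
  previous-injective : Injective _≡_ _≡_ previous
  previous-injective {x} {y} eq
    with LastExit-forward (lastExit-spec x (source x)) | LastExit-forward (lastExit-spec y (source y))
  ... | d , x≡ , awayˣ | d′ , y≡ , awayʸ with <-cmp d d′
  ...   | tri< d<d′ _ _ = contradiction
          (trans (cong source (sym (trans x≡ (cong (λ z → iterate τ (τ z) d) eq)))) same)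
          (awayʸ d<d′)
    where
    same : source x ≡ source y
    same = trans (sym (source-previous x)) (trans (cong source eq) (source-previous y))
  ...   | tri≈ _ refl _ = trans x≡ (trans (cong (λ z → iterate τ (τ z) d) eq) (sym y≡))
  ...   | tri> _ _ d′<d = contradiction
          (trans (cong source (sym (trans y≡ (cong (λ z → iterate τ (τ z) d′) (sym eq))))) same)
          (awayˣ d′<d)
    where
    same : source y ≡ source x
    same = trans (sym (source-previous y)) (trans (cong source (sym eq)) (source-previous x))

  _~_ : E → E → Set
  _~_ = EqClosure (λ x y → previous x ≡ y)

  private
    -- On the way back to the `m`-th arc, each exit from `v` has as its `previous` the next exit
    -- from `v` that is met.
    sameSource-path : ∀ m {z v} → source (iterate κ (κ z) m) ≡ v → lastExit z v ~ iterate κ (κ z) m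
    sameSource-path m {z} {v} eq with source (κ z) ≟ v
    sameSource-path zero    {z} {v} eq | no ¬p = contradiction eq ¬p
    sameSource-path (suc m) {z} {v} eq | no ¬p =
      subst (_~ _) (sym (lastExit-κ ¬p)) (sameSource-path m eq)
    sameSource-path zero    {z} {v} eq | yes p =
      subst (_~ κ z) (sym (LastExit⇒lastExit (here p))) (EqC.reflexive _)
    sameSource-path (suc m) {z} {v} eq | yes refl =
      EqC.transitive _
        (subst (_~ lastExit (κ z) (source (κ z))) (sym (LastExit⇒lastExit (here refl)))
          (EqC.return refl))
        (sameSource-path m eq)

  sameSource⇒~ : ∀ {x y} → source x ≡ source y → x ~ y
  sameSource⇒~ {x} {y} eq with m , refl ← orbit x y =
    EqC.transitive _ (EqC.return refl) (sameSource-path m (sym eq))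

  LastExit-backward : ∀ m {z v} → source (iterate κ (κ z) m) ≡ v →
    ∃ λ i → i ≤ m × lastExit z v ≡ iterate κ (κ z) i
  LastExit-backward m {z} {v} eq with source (κ z) ≟ v
  ... | yes p = 0 , z≤n , LastExit⇒lastExit (here p)
  LastExit-backward zero    eq | no ¬p = contradiction eq ¬p
  LastExit-backward (suc m) eq | no ¬p with i , i≤m , eq′ ← LastExit-backward m eq =
    suc i , s≤s i≤m , trans (lastExit-κ ¬p) eq′

  lastExits-reach-root : ∀ v →
    Reaches (source ∘ τ ∘ lastExit root) (source root) v
  lastExits-reach-root v with m , eq ← orbit root (arc v) =
    subst (Reaches _ _) (trans (cong source eq) (source-arc v)) (go (suc m) ≤-refl)
    where
    -- Going back from the root, the arc after a last exit starts at a vertex met earlier.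
    go : ∀ {m} i → i ≤ m → Reaches (source ∘ τ ∘ lastExit root) (source root) (source (iterate κ root i))
    go zero i≤m = arrived
    go {suc m} (suc i) (s≤s i≤m) with source (iterate κ (κ root) i) ≟ source root
    ... | yes eq = subst (Reaches _ _) (sym eq) arrived
    -- The position can drop from `suc i` to any `j ≤ i`, so the recursion runs on the bound `m`.
    ... | no ¬eq with j , j≤i , eq ← LastExit-backward i {root} refl =
      climb ¬eq (subst (Reaches _ _)
        (cong source (sym (trans (cong τ (trans eq (iterate-suc κ root j))) (τ∘κ _))))
        (go {m} j (≤-trans j≤i i≤m)))

-- The rotor walk

-- `ν` sends an arc to some arc that starts where the former ends. Being injective, it pairs the
-- arcs into a vertex with the arcs out of it: the digraph is balanced. `π` gives the preceding arc
-- at a vertex and `ρ` the following one.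
module RotorWalk
  {E V : Set} (_≟ᴱ_ : DecidableEquality E) (_≟_ : DecidableEquality V)
  {N : ℕ} (code : E → Fin N) (code-injective : Injective _≡_ _≡_ code)
  (source : E → V)
  (ν : E → E) (ν-injective : Injective _≡_ _≡_ ν)
  (π ρ : E → E) (π∘ρ : ∀ x → π (ρ x) ≡ x) (ρ∘π : ∀ x → ρ (π x) ≡ x)
  (source-π : ∀ x → source (π x) ≡ source x)
  (fibre-cyclic : ∀ {x y} → source x ≡ source y → ∃ λ m → iterate π x m ≡ y)
  (final : V → E) (source-final : ∀ v → source (final v) ≡ v)
  (v₀ : V) (reaches : ∀ v → Reaches (source ∘ ν ∘ final) v₀ v)
  where

  open FiniteSet _≟ᴱ_ code code-injective

  abstract
    private
      update : (V → E) → V → E → V → E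
      update ℓ u x v with v ≟ u
      ... | yes _ = x
      ... | no  _ = ℓ v

      state : ℕ → V × (V → E)
      state zero    = v₀ , final
      state (suc m) with state m
      ... | v , ℓ = source (ν (ρ (ℓ v))) , update ℓ v (ρ (ℓ v))

    at : ℕ → V
    at m = proj₁ (state m)

    rotor : ℕ → V → E
    rotor m = proj₂ (state m)

    at-zero : at 0 ≡ v₀
    at-zero = refl

    rotor-zero : ∀ v → rotor 0 v ≡ final v
    rotor-zero v = refl

    at-suc : ∀ m → at (suc m) ≡ source (ν (ρ (rotor m (at m))))
    at-suc m = refl

    rotor-same : ∀ m {v} → v ≡ at m → rotor (suc m) v ≡ ρ (rotor m (at m))
    rotor-same m {v} v≡ with v ≟ at m
    ... | yes _  = refl
    ... | no  v≢ = contradiction v≡ v≢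

    rotor-other : ∀ m {v} → v ≢ at m → rotor (suc m) v ≡ rotor m v
    rotor-other m {v} v≢ with v ≟ at m
    ... | yes v≡ = contradiction v≡ v≢
    ... | no  _  = refl

  -- At step m the walk leaves at m along exit m; rotor m v is the arc along
  -- which it left v most recently, or final v before the first visit.
  exit : ℕ → E
  exit m = ρ (rotor m (at m))

  source-ρ : ∀ x → source (ρ x) ≡ source x
  source-ρ x = trans (sym (source-π (ρ x))) (cong source (π∘ρ x))

  source-rotor : ∀ m v → source (rotor m v) ≡ v
  source-rotor zero    v = trans (cong source (rotor-zero v)) (source-final v)
  source-rotor (suc m) v with v ≟ at m
  ... | yes p = trans (cong source (rotor-same m p))
                  (trans (source-ρ _) (trans (source-rotor m (at m)) (sym p)))
  ... | no ¬p = trans (cong source (rotor-other m ¬p)) (source-rotor m v)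

  source-exit : ∀ m → source (exit m) ≡ at m
  source-exit m = trans (source-ρ _) (source-rotor m (at m))

  Used : ℕ → E → Set
  Used m x = ∃ λ i → i < m × exit i ≡ x

  Used-suc : ∀ {m x} → Used m x → Used (suc m) x
  Used-suc (i , i<m , eq) = i , m<n⇒m<1+n i<m , eq

  Used-split : ∀ {m x} → Used (suc m) x → exit m ≡ x ⊎ Used m x
  Used-split (i , i<1+m , eq) with m≤n⇒m<n∨m≡n (s≤s⁻¹ i<1+m)
  ... | inj₁ i<m  = inj₂ (i , i<m , eq)
  ... | inj₂ refl = inj₁ eq

  rotor-used : ∀ m v → rotor m v ≡ final v ⊎ Used m (rotor m v)
  rotor-used zero    v = inj₁ (rotor-zero v)
  rotor-used (suc m) v with v ≟ at m | rotor-used m v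
  ... | yes p | _       = inj₂ (m , ≤-refl , sym (rotor-same m p))
  ... | no ¬p | inj₁ eq = inj₁ (trans (rotor-other m ¬p) eq)
  ... | no ¬p | inj₂ u  = inj₂ (Used-suc (subst (Used m) (sym (rotor-other m ¬p)) u))

  -- The used arcs at a vertex form an interval of the cyclic order that begins just after `final`:
  -- going back from a used arc leads to used arcs until `final` is met.
  π-used : ∀ m {x} → Used m x → π x ≡ final (source x) ⊎ Used m (π x)
  π-used (suc m) {x} u with Used-split u
  π-used (suc m) {x} u | inj₂ u′ with π-used m u′
  ... | inj₁ eq = inj₁ eq
  ... | inj₂ u″ = inj₂ (Used-suc u″)
  π-used (suc m) {x} u | inj₁ refl with rotor-used m (at m)
  ... | inj₁ eq = inj₁ (trans (π∘ρ _) (trans eq (cong final (sym (source-exit m)))))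
  ... | inj₂ u″ = inj₂ (Used-suc (subst (Used m) (sym (π∘ρ _)) u″))

  used⇒rotor-used : ∀ m {x} → Used m x → Used m (rotor m (source x))
  used⇒rotor-used (suc m) {x} u with source x ≟ at m | Used-split u
  ... | yes p | _         = m , ≤-refl , sym (rotor-same m p)
  ... | no ¬p | inj₁ refl = contradiction (source-exit m) ¬p
  ... | no ¬p | inj₂ u′   =
    Used-suc (subst (Used m) (sym (rotor-other m ¬p)) (used⇒rotor-used m u′))

  private
    exit-full : ∀ m → ¬ Used m (exit m) → Used (suc m) (ρ (exit m)) → exit m ≡ final (at m)
    exit-full m fresh u with Used-split u
    exit-full m fresh u | inj₂ u′ with π-used m u′
    ... | inj₁ eq = trans (sym (π∘ρ _)) (trans eq (cong final (trans (source-ρ _) (source-exit m))))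
    ... | inj₂ u″ = contradiction (subst (Used m) (π∘ρ _) u″) fresh
    -- Here `exit m` follows itself: it is the only arc leaving its vertex, and the rotor already
    -- stood on it.
    exit-full m fresh u | inj₁ eq with rotor-used m (at m)
    ... | inj₁ eq′ = trans fixed eq′
      where
      fixed : exit m ≡ rotor m (at m)
      fixed = trans (sym (π∘ρ _)) (trans (cong π (sym eq)) (π∘ρ _))
    ... | inj₂ u″ = contradiction (subst (Used m) fixed u″) fresh
      where
      fixed : rotor m (at m) ≡ exit m
      fixed = trans (sym (π∘ρ _)) (trans (cong π eq) (π∘ρ _))

  -- Since used arcs form an interval starting just after `final v`, a rotor that is about to turn
  -- to a used arc has come full circle.
  rotor-full : ∀ m {v} → InjectiveBelow exit m → Used m (ρ (rotor m v)) → rotor m v ≡ final v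
  rotor-full (suc m) {v} distinct u with v ≟ at m
  ... | yes refl = trans (rotor-same m refl) (exit-full m
          (λ (i , i<m , eq) → distinct i<m ≤-refl eq)
          (subst (Used (suc m) ∘ ρ) (rotor-same m refl) u))
  ... | no ¬p with Used-split (subst (Used (suc m) ∘ ρ) (rotor-other m ¬p) u)
  ...   | inj₁ eq = contradiction
            (trans (sym (source-rotor m v))
              (trans (sym (source-ρ _)) (trans (cong source (sym eq)) (source-exit m)))) ¬p
  ...   | inj₂ u′ = trans (rotor-other m ¬p)
            (rotor-full m (λ a<b b<m → distinct a<b (m<n⇒m<1+n b<m)) u′)

  -- The walk closes up at its first repeated arc.

  abstract
    repeat : FirstRepeat exit
    repeat = firstRepeat exit

  length : ℕ
  length = proj₁ (proj₂ repeat)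

  exit-distinct : InjectiveBelow exit length
  exit-distinct with _ , _ , _ , _ , d ← repeat = d

  exit-injective : ∀ {a b} → a < length → b < length → exit a ≡ exit b → a ≡ b
  exit-injective {a} {b} a<l b<l eq with <-cmp a b
  ... | tri< a<b _ _ = contradiction eq (exit-distinct a<b b<l)
  ... | tri≈ _ eq′ _ = eq′
  ... | tri> _ _ b<a = contradiction (sym eq) (exit-distinct b<a a<l)

  repeated : Used length (exit length)
  repeated with j , _ , j<l , eq , _ ← repeat = j , j<l , eq

  0<length : 0 < length
  0<length with j , _ , j<l , _ ← repeat = ≤-trans (s≤s z≤n) j<l

  before : ℕ → ℕ
  before zero    = pred length
  before (suc i) = i

  suc-pred-length : suc (pred length) ≡ length
  suc-pred-length = suc-pred length {{>-nonZero 0<length}}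

  before<length : ∀ {i} → i < length → before i < length
  before<length {zero}  _     = ≤-reflexive suc-pred-length
  before<length {suc i} 1+i<l = <⇒≤ 1+i<l

  before-injective : ∀ {i j} → i < length → j < length → before i ≡ before j → i ≡ j
  before-injective {zero}  {zero}  _ _ _  = refl
  before-injective {suc i} {suc j} _ _ eq = cong suc eq
  before-injective {zero}  {suc j} _ j<l eq =
    contradiction (trans (cong suc (sym eq)) suc-pred-length) (<⇒≢ j<l)
  before-injective {suc i} {zero}  i<l _ eq =
    contradiction (trans (cong suc eq) suc-pred-length) (<⇒≢ i<l)

  AllUsed : V → Set
  AllUsed v = ∀ {x} → source x ≡ v → Used length x

  -- `final v` comes last in the order at `v`. Going back from it around the fibre, a step stays
  -- among used arcs unless it meets `final v` again, and that one is used.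
  final-used⇒allUsed : ∀ {v} → Used length (final v) → AllUsed v
  final-used⇒allUsed {v} used {x} eq
    with m , refl ← fibre-cyclic (trans (source-final v) (sym eq)) = go m used (source-final v)
    where
    step : ∀ {z} → Used length z → source z ≡ v → Used length (π z)
    step u eq with π-used length u
    ... | inj₁ eq′ = subst (Used length) (sym (trans eq′ (cong final eq))) used
    ... | inj₂ u′  = u′
    go : ∀ m {z} → Used length z → source z ≡ v → Used length (iterate π z m)
    go zero    u _  = u
    go (suc m) u eq = go m (step u eq) (trans (source-π _) eq)

  -- If the walk leaves v along every arc from v, then it enters v equally
  -- often, hence along every arc to v.
  module _ {v : V} (allUsed : AllUsed v) (closes : v ≡ v₀ → at length ≡ v) where

    private
      -- This replaces the count of entries and exits. An exit from `v` goes to `ν` of the arc by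
      -- which the walk had just entered; all other arcs are fixed. Being injective on a finite set,
      -- the map is onto, so it hits `ν y` for every arc `y` into `v`.
      entry : E → E
      entry x with source x ≟ v
      ... | yes p = ν (exit (before (proj₁ (allUsed p))))
      ... | no  _ = x

      at-entered : ∀ i → i < length → at i ≡ v → source (ν (exit (before i))) ≡ v
      -- The exit at time 0 has no entry before it. There `v` is `v₀`, and `closes` lets the last
      -- arc of the walk serve as the entry.
      at-entered zero    _ eq = trans (sym (at-suc _))
        (trans (cong at suc-pred-length) (closes (trans (sym eq) at-zero)))
      at-entered (suc i) _ eq = trans (sym (at-suc i)) eq

      source-entry : ∀ {x} (u : Used length x) → source x ≡ v →
                     source (ν (exit (before (proj₁ u)))) ≡ v
      source-entry (i , i<l , eq) p = at-entered i i<l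
        (trans (sym (source-exit i)) (trans (cong source eq) p))

      entry-injective : Injective _≡_ _≡_ entry
      entry-injective {x} {y} eq with source x ≟ v | source y ≟ v
      ... | yes p | no ¬q = contradiction (trans (cong source (sym eq)) (source-entry (allUsed p) p)) ¬q
      ... | no ¬p | yes q = contradiction (trans (cong source eq) (source-entry (allUsed q) q)) ¬p
      ... | no _  | no _  = eq
      ... | yes p | yes q with allUsed p | allUsed q
      ...   | i , i<l , refl | j , j<l , refl = cong exit
              (before-injective i<l j<l
                (exit-injective (before<length i<l) (before<length j<l) (ν-injective eq)))

    enteredBy : ∀ {y} → source (ν y) ≡ v → ∃ λ i → i < length × at i ≡ v × exit (before i) ≡ y
    enteredBy {y} eq with injective⇒surjective entry-injective (ν y)
    ... | x , eq′ with source x ≟ v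
    ...   | no ¬p = contradiction (trans (cong source eq′) eq) ¬p
    ...   | yes p with allUsed p
    ...     | i , i<l , refl = i , i<l , trans (sym (source-exit i)) p , ν-injective eq′

    entriesUsed : ∀ {y} → source (ν y) ≡ v → Used length y
    entriesUsed eq with i , i<l , _ , eq′ ← enteredBy eq = before i , before<length i<l , eq′

  -- The repeated arc is the one that the rotor turns to next, so the rotor has come full circle and
  -- stands on `final`. It also stands on a used arc, since the walk has left this vertex before.
  allUsed-end : AllUsed (at length)
  allUsed-end = final-used⇒allUsed (subst (Used length) full used)
    where
    full : rotor length (at length) ≡ final (at length)
    full = rotor-full length exit-distinct repeated
    used : Used length (rotor length (at length))
    used = subst (Used length ∘ rotor length) (source-exit length) (used⇒rotor-used length repeated)

  -- Elsewhere, the walk would have entered its end vertex once more than it left it: the entry by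
  -- the last arc could only be paired with an exit at time 0, which is made from `v₀`.
  ends-at-start : at length ≡ v₀
  ends-at-start with at length ≟ v₀
  ... | yes eq = eq
  ... | no ¬eq with enteredBy allUsed-end (λ _ → refl) {exit (pred length)}
                            (trans (sym (at-suc _)) (cong at suc-pred-length))
  ...   | zero  , _   , eq , _   = contradiction (trans (sym eq) at-zero) ¬eq
  ...   | suc i , i<l , _  , eq′ = contradiction
          (before-injective {suc i} {0} i<l 0<length
            (exit-injective (<⇒≤ i<l) (before<length 0<length) eq′)) λ ()

  -- Once all exits from the parent of `v` are used, so are all entries to it, among them `final v`;
  -- and this is the last arc that the walk uses to leave `v`.
  allUsed-everywhere : ∀ {v} → Reaches (source ∘ ν ∘ final) v₀ v → AllUsed v
  allUsed-everywhere arrived     = subst AllUsed ends-at-start allUsed-end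
  allUsed-everywhere (climb _ r) =
    final-used⇒allUsed (entriesUsed (allUsed-everywhere r) (trans ends-at-start ∘ sym) refl)

  abstract
    used : ∀ x → Used length x
    used x = allUsed-everywhere (reaches (source x)) refl

  rotor-length : ∀ v → rotor length v ≡ final v
  rotor-length v = rotor-full length exit-distinct (used _)

  SameState : ℕ → ℕ → Set
  SameState i j = at i ≡ at j × (∀ v → rotor i v ≡ rotor j v)

  SameState⇒exit : ∀ {i j} → SameState i j → exit i ≡ exit j
  SameState⇒exit {i} (eq , eqs) = cong ρ (trans (cong (rotor i) eq) (eqs _))

  SameState-suc : ∀ {i j} → SameState i j → SameState (suc i) (suc j)
  SameState-suc {i} {j} same@(eq , eqs) =
    trans (at-suc i) (trans (cong (source ∘ ν) exits) (sym (at-suc j))) , rotors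
    where
    exits : exit i ≡ exit j
    exits = SameState⇒exit same
    rotors : ∀ v → rotor (suc i) v ≡ rotor (suc j) v
    rotors v with v ≟ at j
    ... | yes p = trans (rotor-same i (trans p (sym eq))) (trans exits (sym (rotor-same j p)))
    ... | no ¬p = trans (rotor-other i (¬p ∘ (λ q → trans q eq)))
                    (trans (eqs v) (sym (rotor-other j ¬p)))

  SameState-length : ∀ m → SameState (m + length) m
  SameState-length zero    = trans ends-at-start (sym at-zero) ,
    λ v → trans (rotor-length v) (sym (rotor-zero v))
  SameState-length (suc m) = SameState-suc (SameState-length m)

  reduce : ∀ i → ∃ λ j → j < length × SameState i j
  reduce zero = 0 , 0<length , refl , λ _ → refl
  reduce (suc i) with j , j<l , same ← reduce i with m≤n⇒m<n∨m≡n j<l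
  ... | inj₁ 1+j<l = suc j , 1+j<l , SameState-suc same
  ... | inj₂ 1+j≡l with eq , eqs ← subst (SameState (suc i)) 1+j≡l (SameState-suc same)
    with eq′ , eqs′ ← SameState-length 0 =
    0 , 0<length , trans eq eq′ , λ v → trans (eqs v) (eqs′ v)

  private
    index : E → ℕ
    index x = proj₁ (used x)

    index<length : ∀ x → index x < length
    index<length x = proj₁ (proj₂ (used x))

    exit-index : ∀ x → exit (index x) ≡ x
    exit-index x = proj₂ (proj₂ (used x))

    abstract
      τ κ : E → E
      τ x = exit (suc (index x))
      κ x = exit (before (index x))

      τ-index : ∀ x → τ x ≡ exit (suc (index x))
      τ-index x = refl

      κ-index : ∀ x → κ x ≡ exit (before (index x))
      κ-index x = refl

    exit-suc : ∀ {i j} → exit i ≡ exit j → exit (suc i) ≡ exit (suc j)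
    exit-suc {i} {j} eq with i′ , i′<l , same ← reduce i | j′ , j′<l , same′ ← reduce j
      with refl ← exit-injective i′<l j′<l
             (trans (sym (SameState⇒exit same)) (trans eq (SameState⇒exit same′))) =
      trans (SameState⇒exit (SameState-suc same)) (sym (SameState⇒exit (SameState-suc same′)))

    τ-exit : ∀ i → τ (exit i) ≡ exit (suc i)
    τ-exit i = trans (τ-index (exit i)) (exit-suc (exit-index (exit i)))

    exit-suc-before : ∀ i → exit (suc (before i)) ≡ exit i
    exit-suc-before zero    = trans (cong exit suc-pred-length) (SameState⇒exit (SameState-length 0))
    exit-suc-before (suc i) = refl

    τ∘κ : ∀ x → τ (κ x) ≡ x
    τ∘κ x = trans (cong τ (κ-index x)) (trans (τ-exit _) (trans (exit-suc-before (index x)) (exit-index x)))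

    κ-injective : Injective _≡_ _≡_ κ
    κ-injective eq = trans (sym (τ∘κ _)) (trans (cong τ eq) (τ∘κ _))

    κ∘τ : ∀ x → κ (τ x) ≡ x
    κ∘τ x with y , refl ← injective⇒surjective κ-injective x = cong κ (τ∘κ y)

    κ-iterate : ∀ m i → iterate κ (exit (m + i)) m ≡ exit i
    κ-iterate zero    i = refl
    κ-iterate (suc m) i =
      trans (cong (λ z → iterate κ z m) (trans (cong κ (sym (τ-exit (m + i)))) (κ∘τ _)))
            (κ-iterate m i)

    orbit : ∀ z x → ∃ λ m → iterate κ (κ z) m ≡ x
    -- Shifting the time of `κ z` by one full `length` makes it later than that of `x`, so that `x`
    -- lies `d` steps back.
    orbit z x with d , eq ← m≤n⇒∃[o]m+o≡n (≤-trans (<⇒≤ (index<length x)) (m≤n+m length (before (index z)))) =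
      d , (begin
        iterate κ (κ z) d                 ≡⟨ cong (λ z → iterate κ z d) (begin
          κ z                               ≡⟨ κ-index z ⟩
          exit (before (index z))           ≡⟨ SameState⇒exit (SameState-length (before (index z))) ⟨
          exit (before (index z) + length)  ≡⟨ cong exit (trans (sym eq) (+-comm (index x) d)) ⟩
          exit (d + index x)                ∎) ⟩
        iterate κ (exit (d + index x)) d  ≡⟨ κ-iterate d (index x) ⟩
        exit (index x)                    ≡⟨ exit-index x ⟩
        x                                 ∎)
      where open ≡-Reasoning

  tour : Tour E V
  tour = record
    { source = source ; τ = τ ; κ = κ ; τ∘κ = τ∘κ ; κ∘τ = κ∘τ ; root = ρ (final v₀)
    ; orbit = orbit ; arc = final ; source-arc = source-final }

  open Exits _≟_ tour using (lastExit; previous; lastExit-here; lastExit-there)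

  source-τ : ∀ x → source (τ x) ≡ source (ν x)
  source-τ x = trans (cong source (τ-index x)) (trans (source-exit (suc (index x)))
    (trans (at-suc _) (cong (source ∘ ν) (exit-index x))))

  private
    -- Before the first visit to `v` the rotor shows `final v` by definition and records no exit.
    -- Hence the applications are made one round later, at times from `length` on.
    lastExit-exit : ∀ m {v} → (∃ λ i → i < m × at i ≡ v) → lastExit (exit m) v ≡ rotor m v
    lastExit-exit (suc m) {v} (i , i<1+m , eq) with v ≟ at m
    ... | yes refl = trans (cong₂ lastExit (sym (τ-exit m)) (sym (source-exit m)))
                       (trans (lastExit-here (exit m)) (sym (rotor-same m refl)))
    ... | no ¬p with m≤n⇒m<n∨m≡n (s≤s⁻¹ i<1+m)
    ...   | inj₂ refl = contradiction (sym eq) ¬p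
    ...   | inj₁ i<m  = trans (cong (λ z → lastExit z v) (sym (τ-exit m)))
              (trans (lastExit-there (¬p ∘ sym ∘ trans (sym (source-exit m))))
                     (trans (lastExit-exit m (i , i<m , eq)) (sym (rotor-other m ¬p))))

    visited : ∀ m v → ∃ λ i → i < m + length × at i ≡ v
    visited m v = index (final v) , m≤n⇒m≤o+n m (index<length (final v)) ,
      trans (sym (source-exit _)) (trans (cong source (exit-index _)) (source-final v))

  lastExit-root : ∀ v → lastExit (ρ (final v₀)) v ≡ final v
  lastExit-root v =
    trans (cong (λ z → lastExit z v) root≡)
      (trans (lastExit-exit length (visited 0 v)) (rotor-length v))
    where
    root≡ : ρ (final v₀) ≡ exit length
    root≡ = trans (cong ρ (trans (sym (rotor-zero v₀)) (cong (rotor 0) (sym at-zero))))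
                  (sym (SameState⇒exit (SameState-length 0)))

  previous≡π : ∀ x → previous x ≡ π x
  previous≡π x = trans (cong previous (sym x≡)) (trans (begin
      previous (exit m)               ≡⟨ cong (lastExit (exit m)) (source-exit m) ⟩
      lastExit (exit m) (at m)        ≡⟨ lastExit-exit m (visited (index x) (at m)) ⟩
      rotor m (at m)                  ≡⟨ π∘ρ _ ⟨
      π (exit m)                      ∎) (cong π x≡))
    where
    open ≡-Reasoning
    m = index x + length
    x≡ : exit m ≡ x
    x≡ = trans (SameState⇒exit (SameState-length (index x))) (exit-index x)

  abstract
    rotorTour : ∃ λ (W : Tour E V) →
      (∀ x → Tour.source W x ≡ source x) ×
      (∀ x → source (Tour.τ W x) ≡ source (ν x)) ×
      (∀ v → Exits.lastExit _≟_ W (ρ (final v₀)) v ≡ final v) ×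
      (∀ x → Exits.previous _≟_ W x ≡ π x)
    rotorTour = tour , (λ _ → refl) , source-τ , lastExit-root , previous≡π

-- Arborescences

toℕ-mod : ∀ m n .{{_ : NonZero n}} → toℕ (m mod n) ≡ m % n
toℕ-mod m n = Fin.toℕ-fromℕ< (m%n<n m n)

mod-cong : ∀ m m′ n .{{_ : NonZero n}} → m % n ≡ m′ % n → m mod n ≡ m′ mod n
mod-cong m m′ n eq = Fin.toℕ-injective (trans (toℕ-mod m n) (trans eq (sym (toℕ-mod m′ n))))

nextType-mod : ∀ {k} m → nextType (m mod suc k) ≡ suc m mod suc k
nextType-mod {k} m = mod-cong (suc (toℕ (m mod suc k))) (suc m) (suc k) (begin
  suc (toℕ (m mod suc k)) % suc k  ≡⟨ cong (λ i → suc i % suc k) (toℕ-mod m (suc k)) ⟩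
  (1 + m % suc k) % suc k          ≡⟨ %-distribˡ-+ 1 (m % suc k) (suc k) ⟩
  (1 % suc k + m % suc k % suc k) % suc k ≡⟨ cong (λ i → (1 % suc k + i) % suc k) (m%n%n≡m%n m (suc k)) ⟩
  (1 % suc k + m % suc k) % suc k  ≡⟨ %-distribˡ-+ 1 m (suc k) ⟨
  suc m % suc k                    ∎)
  where open ≡-Reasoning

toℕ-mod-inverse : ∀ {k} (t : Fin (suc k)) → toℕ t mod suc k ≡ t
toℕ-mod-inverse {k} t = Fin.toℕ-injective
  (trans (toℕ-mod (toℕ t) (suc k)) (m<n⇒m%n≡m (Fin.toℕ<n t)))

nextType-injective : ∀ {k} → Injective _≡_ _≡_ (nextType {k})
nextType-injective {suc k} {t} {u} eq = trans (sym (recover t)) (trans (cong back eq) (recover u))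
  where
  -- Adding `k` modulo `suc k` subtracts one.
  back : Fin (suc k) → Fin (suc k)
  back t = (k + toℕ t) mod suc k
  recover : ∀ t → back (nextType t) ≡ t
  recover t = trans (mod-cong (k + toℕ (nextType t)) (toℕ t) (suc k) (begin
    (k + toℕ (suc (toℕ t) mod suc k)) % suc k
      ≡⟨ cong (λ i → (k + i) % suc k) (toℕ-mod (suc (toℕ t)) (suc k)) ⟩
    (k + suc (toℕ t) % suc k) % suc k  ≡⟨ %-distribˡ-+ k (suc (toℕ t) % suc k) (suc k) ⟩
    (k % suc k + suc (toℕ t) % suc k % suc k) % suc k
      ≡⟨ cong (λ i → (k % suc k + i) % suc k) (m%n%n≡m%n (suc (toℕ t)) (suc k)) ⟩
    (k % suc k + suc (toℕ t) % suc k) % suc k ≡⟨ %-distribˡ-+ k (suc (toℕ t)) (suc k) ⟨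
    (k + suc (toℕ t)) % suc k          ≡⟨ cong (_% suc k) (trans (+-suc k (toℕ t)) (+-comm (suc k) (toℕ t))) ⟩
    (toℕ t + suc k) % suc k            ≡⟨ [m+n]%n≡m%n (toℕ t) (suc k) ⟩
    toℕ t % suc k                      ∎)) (toℕ-mod-inverse t)
    where open ≡-Reasoning

nextType≢ : ∀ {k} .{{_ : NonTrivial k}} (t : Fin k) → nextType t ≢ t
nextType≢ {suc (suc k)} t eq with m≤n⇒m<n∨m≡n (Fin.toℕ<n t)
... | inj₁ 1+t<k = contradiction (begin
  suc (toℕ t)                 ≡⟨ m<n⇒m%n≡m 1+t<k ⟨
  suc (toℕ t) % suc (suc k)   ≡⟨ toℕ-mod (suc (toℕ t)) (suc (suc k)) ⟨
  toℕ (nextType t)            ≡⟨ cong toℕ eq ⟩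
  toℕ t                       ∎) 1+n≢n
  where open ≡-Reasoning
... | inj₂ 1+t≡k = contradiction (begin
  suc k                       ≡⟨ suc-injective 1+t≡k ⟨
  toℕ t                       ≡⟨ cong toℕ eq ⟨
  toℕ (nextType t)            ≡⟨ toℕ-mod (suc (toℕ t)) (suc (suc k)) ⟩
  suc (toℕ t) % suc (suc k)   ≡⟨ cong (_% suc (suc k)) 1+t≡k ⟩
  suc (suc k) % suc (suc k)   ≡⟨ n%n≡0 (suc (suc k)) ⟩
  0                           ∎) λ ()
  where open ≡-Reasoning

Arc : ℕ → ℕ → Set
Arc k n = Fin k × Fin n

_≟ᵃ_ : ∀ {k n} → DecidableEquality (Arc k n)
_≟ᵃ_ = ≡-dec Fin._≟_ Fin._≟_

arcCode : ∀ {k n} → Arc k n → Fin (k * n)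
arcCode (t , h) = combine t h

arcCode-injective : ∀ {k n} → Injective _≡_ _≡_ (arcCode {k} {n})
arcCode-injective {x = t , h} {u , g} eq
  with refl , refl ← Fin.combine-injective t h u g eq = refl

-- The vertices of the glued digraph.
TypedLabel : ∀ {k} → (Fin k → ℕ) → Set
TypedLabel {k} p = Σ (Fin k) λ t → Fin (p t)

_≟ˡ_ : ∀ {k} {p : Fin k → ℕ} → DecidableEquality (TypedLabel p)
_≟ˡ_ = ≡-dec Fin._≟_ Fin._≟_

along : ∀ {k n} → Arc k n → Arc k n
along (t , h) = nextType t , h

along-injective : ∀ {k n} → Injective _≡_ _≡_ (along {k} {n})
along-injective eq = cong₂ _,_ (nextType-injective (,-injectiveˡ eq)) (cong proj₂ eq)

-- `source` names the vertices of `C` in a type with decidable equality. An arc is used as its own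
-- first end, so `source` applies to vertices and edges alike.
module Arborescence {k n} .{{_ : NonTrivial k}} (C : Constellation k n)
  (root : Constellation.Vertex C)
  {V : Set} (_≟_ : DecidableEquality V) (source : Arc k n → V)
  (≈⇒source : ∀ {x y} → Constellation._≈ᵥ_ C x y → source x ≡ source y)
  (source⇒≈ : ∀ {x y} → source x ≡ source y → Constellation._≈ᵥ_ C x y)
  where

  open Constellation C hiding (source)

  ≈-refl : ∀ {x} → x ≈ᵥ x
  ≈-refl = Setoid.refl vertices

  v₀ : V
  v₀ = source root

  module _ (final : V → Arc k n) (source-final : ∀ v → source (final v) ≡ v)
           (reaches : ∀ v → Reaches (source ∘ along ∘ final) v₀ v)
           (tree : EdgeSet)
           (tree⇒final : ∀ {e} → T (tree e) → source e ≢ v₀ × final (source e) ≡ e)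
           (final⇒tree : ∀ {v} → v ≢ v₀ → T (tree (final v)))
           where

    private
      parent : V → V
      parent = source ∘ along ∘ final

      rank : ∀ {v} → Reaches parent v₀ v → ℕ
      rank arrived     = 0
      rank (climb _ r) = suc (rank r)

      rank-unique : ∀ {v} (r s : Reaches parent v₀ v) → rank r ≡ rank s
      rank-unique arrived     arrived      = refl
      rank-unique arrived     (climb v≢ _) = contradiction refl v≢
      rank-unique (climb v≢ _) arrived     = contradiction refl v≢
      rank-unique (climb _ r) (climb _ s)  = cong suc (rank-unique r s)

      height : Vertex → ℕ
      height u = rank (reaches (source u))

      height-cong : ∀ {u v} → source u ≡ source v → height u ≡ height v
      height-cong eq = cong (λ v → rank (reaches v)) eq

      height-tree : ∀ {e} → T (tree e) → height e ≡ suc (height (along e))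
      height-tree {e} te with e≢ , eq ← tree⇒final te =
        trans (rank-unique (reaches (source e)) (climb e≢ (reaches _)))
              (cong (λ x → suc (height (along x))) eq)

      module _ {e : Edge} {u v : Vertex} (te : T (tree e)) where

        Ascends Descends : Set
        Ascends  = height v < height u × final (source u) ≡ e
        Descends = height u < height v × final (source v) ≡ e

        direction : Joins e u v → Ascends ⊎ Descends
        direction (inj₁ (p , q)) = inj₁ (lower , trans (cong final (sym (≈⇒source p))) (proj₂ (tree⇒final te)))
          where
          lower : height v < height u
          lower = ≤-reflexive (trans (cong suc (sym (height-cong (≈⇒source q))))
                    (trans (sym (height-tree te)) (height-cong (≈⇒source p))))
        direction (inj₂ (p , q)) = inj₂ (lower , trans (cong final (sym (≈⇒source p))) (proj₂ (tree⇒final te)))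
          where
          lower : height u < height v
          lower = ≤-reflexive (trans (cong suc (sym (height-cong (≈⇒source q))))
                    (trans (sym (height-tree te)) (height-cong (≈⇒source p))))

      -- A walk in the tree without repeated edges first ascends towards the
      -- root and then descends.
      descending : ∀ {u v} (w : Walk tree u v) → Unique (walkEdges w) →
                   All (final (source u) ≢_) (walkEdges w) →
                   source u ≡ source v ⊎ height u < height v × final (source v) ∈ walkEdges w
      descending (stop p) _ _ = inj₁ (≈⇒source p)
      descending (step {v = v′} e te j w) (e∉w ∷ uniq) (u≢e ∷ _) with direction te j
      ... | inj₁ (_ , eq) = contradiction eq u≢e
      ... | inj₂ (u<v′ , refl) with descending w uniq e∉w
      ...   | inj₁ eq = inj₂ (≤-trans u<v′ (≤-reflexive (height-cong eq)) , here (cong final (sym eq)))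
      ...   | inj₂ (v′<v , ∈w) = inj₂ (<-trans u<v′ v′<v , there ∈w)

      -- A walk that descends at all arrives along the arc of its end vertex. In `acyclic` this
      -- would be the arc by which the cycle set out upwards, now used twice.
      ascending : ∀ {u v} (w : Walk tree u v) → Unique (walkEdges w) →
                  source u ≡ source v ⊎ height v < height u ⊎ final (source v) ∈ walkEdges w
      ascending (stop p) _ = inj₁ (≈⇒source p)
      ascending (step e te j w) (e∉w ∷ uniq) with direction te j
      ... | inj₂ (_ , refl) with descending w uniq e∉w
      ...   | inj₁ eq       = inj₂ (inj₂ (here (cong final (sym eq))))
      ...   | inj₂ (_ , ∈w) = inj₂ (inj₂ (there ∈w))
      ascending (step e te j w) (e∉w ∷ uniq) | inj₁ (v′<u , _) with ascending w uniq
      ... | inj₁ eq          = inj₂ (inj₁ (≤-trans (s≤s (≤-reflexive (sym (height-cong eq)))) v′<u))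
      ... | inj₂ (inj₁ v<v′) = inj₂ (inj₁ (<-trans v<v′ v′<u))
      ... | inj₂ (inj₂ ∈w)   = inj₂ (inj₂ (there ∈w))

      acyclic : ∀ {v} (w : Walk tree v v) → ¬ IsCycle w
      acyclic (stop _) (nonempty , _) = nonempty refl
      acyclic (step e te j w) (_ , e∉w ∷ uniq , _) with direction te j
      ... | inj₂ (v<v′ , refl) with descending w uniq e∉w
      ...   | inj₁ eq         = contradiction (height-cong (sym eq)) (<⇒≢ v<v′)
      ...   | inj₂ (v′<v , _) = <-asym v<v′ v′<v
      acyclic (step e te j w) (_ , e∉w ∷ uniq , _) | inj₁ (v′<v , refl) with ascending w uniq
      ... | inj₁ eq          = contradiction (height-cong eq) (<⇒≢ v′<v)
      ... | inj₂ (inj₁ v<v′) = <-asym v<v′ v′<v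
      ... | inj₂ (inj₂ ∈w)   = lookup e∉w ∈w refl

      startAt : ∀ {u u′ v} → u ≈ᵥ u′ → Walk tree u v → Walk tree u′ v
      startAt eq (stop p) = stop (Setoid.trans vertices (Setoid.sym vertices eq) p)
      startAt eq (step e te (inj₁ (p , q)) w) = step e te (inj₁ (Setoid.trans vertices p eq , q)) w
      startAt eq (step e te (inj₂ (p , q)) w) = step e te (inj₂ (p , Setoid.trans vertices q eq)) w

      reverseAppend : ∀ {u v w} → Walk tree v u → Walk tree v w → Walk tree u w
      reverseAppend (stop p)         w′ = startAt p w′
      reverseAppend (step e te j w)  w′ = reverseAppend w (step e te (swap j) w′)

      toRoot : ∀ {v} → Reaches parent v₀ v → ∀ {u} → source u ≡ v → Walk tree u root
      toRoot arrived eq = stop (source⇒≈ eq)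
      toRoot (climb {v} v≢ r) eq = step (final v) (final⇒tree v≢)
        (inj₁ (source⇒≈ (trans (source-final v) (sym eq)) , ≈-refl)) (toRoot r refl)

      connected : ∀ u v → Walk tree u v
      connected u v = reverseAppend (fromRoot u) (fromRoot v)
        where
        fromRoot : ∀ u → Walk tree root u
        fromRoot u = reverseAppend (toRoot (reaches (source u)) refl) (stop ≈-refl)

    isArborescence : (∀ {x y} → source x ≡ source y → proj₁ x ≡ proj₁ y) →
                     IsArborescence root tree
    isArborescence sameType = record
      { isSpanningTree = record { connected = connected ; acyclic = acyclic }
      ; uniqueEdge = λ v v≉ → final (source v)
          , ( final⇒tree (v≉ ∘ source⇒≈)
            , sameType (source-final (source v))
            , inj₁ (source⇒≈ (source-final (source v))))
          , λ { {e} (te , _ , inj₁ p) →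
                  trans (cong final (sym (≈⇒source p))) (proj₂ (tree⇒final te))
              -- For k at least 2 the target of an edge differs from it in type, so the edges of
              -- type t at a vertex of type t are exactly the arcs leaving it.
              ; {e} (te , same , inj₂ (q , _)) →
                  contradiction (trans q (sym same)) (nextType≢ (proj₁ e)) }
      }

  module _ (tree : EdgeSet) (arborescence : IsArborescence root tree)
           (final : V → Arc k n) (source-final : ∀ v → source (final v) ≡ v) where

    open IsArborescence arborescence
    open FiniteSet (_≟ᵃ_ {k} {n}) arcCode arcCode-injective

    private
      directedWalk : ∀ (f : ℕ → Arc k n) d {v} → (∀ i → source (along (f i)) ≡ source (f (suc i))) →
        (∀ {i} → i < d → T (tree (f i))) → source (f d) ≡ source v →
        ∃ λ (w : Walk tree (f 0) v) → walkEdges w ≡ applyUpTo f d × walkVertices w ≡ applyUpTo f d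
      directedWalk f zero    next inTree end = stop (source⇒≈ end) , refl , refl
      directedWalk f (suc d) next inTree end
        with w , es , vs ← directedWalk (f ∘ suc) d (next ∘ suc) (inTree ∘ s≤s) end =
        step (f 0) (inTree (s≤s z≤n)) (inj₁ (≈-refl , source⇒≈ (next 0))) w
        , cong (f 0 ∷_) es , cong (f 0 ∷_) vs

    parent : V → V
    parent = source ∘ along ∘ final

    -- If all these arcs were in the tree, the stretch up to the first repeated arc would contain a
    -- cycle. `final` may be any choice of outgoing arcs, which `root-not-inTree` exploits with a
    -- modified one.
    leavesTree : ∀ v → ∃ λ i → ¬ T (tree (final (iterate parent v i)))
    leavesTree v with firstRepeat (λ i → final (iterate parent v i))
    ... | j , m , j<m , eq , distinct
        with anyUpTo? (λ i → ¬? (T? (tree (final (iterate parent v i))))) m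
    ...   | yes (i , _ , ¬t) = i , ¬t
    ...   | no none with d , refl ← m≤n⇒∃[o]m+o≡n j<m =
      let w , es , vs = closed in
      contradiction (cycle w es vs) (IsSpanningTree.acyclic isSpanningTree w)
      where
      f : ℕ → Arc k n
      f i = final (iterate parent v i)
      g : ℕ → Arc k n
      g i = f (j + i)
      next : ∀ i → source (along (g i)) ≡ source (g (suc i))
      next i = sym (begin
        source (f (j + suc i))        ≡⟨ source-final _ ⟩
        iterate parent v (j + suc i)  ≡⟨ cong (iterate parent v) (+-suc j i) ⟩
        iterate parent v (suc j + i)  ≡⟨ iterate-suc parent v (j + i) ⟩
        source (along (g i))          ∎)
        where open ≡-Reasoning
      bound : ∀ {i} → i < suc d → j + i < suc j + d
      bound {i} i<1+d = subst (j + i <_) (+-suc j d) (+-monoʳ-< j i<1+d)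
      closed : ∃ λ (w : Walk tree (g 0) (g 0)) →
        walkEdges w ≡ applyUpTo g (suc d) × walkVertices w ≡ applyUpTo g (suc d)
      closed = directedWalk g (suc d) next
        (λ {i} i<1+d → decidable-stable (T? _) (λ ¬t → none (j + i , bound i<1+d , ¬t)))
        (cong source (trans (cong f (+-suc j d)) (trans (sym eq) (cong f (sym (+-identityʳ j))))))
      apart : ∀ {a b} → a < b → b < suc d → g a ≢ g b
      apart a<b b<1+d = distinct (+-monoʳ-< j a<b) (bound b<1+d)
      source-apart : ∀ {a b} → a < b → b < suc d → ¬ (g a ≈ᵥ g b)
      source-apart a<b b<1+d p = apart a<b b<1+d
        (cong final (trans (sym (source-final _)) (trans (≈⇒source p) (source-final _))))
      cycle : ∀ {u} (w : Walk tree u u) → walkEdges w ≡ applyUpTo g (suc d) →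
              walkVertices w ≡ applyUpTo g (suc d) → IsCycle w
      cycle w es vs =
        subst (_≢ []) (sym es) (λ ())
        , subst Unique (sym es) (Unique.applyUpTo⁺₁ g (suc d) apart)
        , subst (UniqueSetoid.Unique vertices) (sym vs)
            (UniqueSetoid.applyUpTo⁺₁ vertices g (suc d) source-apart)

  module _ (tree : EdgeSet) (arborescence : IsArborescence root tree)
           (final : V → Arc k n) (source-final : ∀ v → source (final v) ≡ v)
           (final-inTree : ∀ {v} → v ≢ v₀ → T (tree (final v))) where

    -- Only `v₀` can have its chosen arc outside the tree, so a path that leaves the tree does so at
    -- `v₀`.
    arborescence-reaches : ∀ v → Reaches (source ∘ along ∘ final) v₀ v
    arborescence-reaches v with i , ¬t ← leavesTree tree arborescence final source-final v = go i ¬t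
      where
      go : ∀ i {v} → ¬ T (tree (final (iterate (source ∘ along ∘ final) v i))) →
           Reaches (source ∘ along ∘ final) v₀ v
      go i {v} ¬t with v ≟ v₀
      go i       ¬t | yes refl = arrived
      go zero    ¬t | no v≢    = contradiction (final-inTree v≢) ¬t
      go (suc i) ¬t | no v≢    = climb v≢ (go i ¬t)

    -- Otherwise every vertex would have an outgoing tree edge.
    root-not-inTree : ∀ {e} → T (tree e) → source e ≢ v₀
    root-not-inTree {e} te e≡ = proj₂ leaves (inTree _)
      where
      final′ : V → Arc k n
      final′ v with v ≟ v₀
      ... | yes _ = e
      ... | no  _ = final v
      source-final′ : ∀ v → source (final′ v) ≡ v
      source-final′ v with v ≟ v₀
      ... | yes v≡ = trans e≡ (sym v≡)
      ... | no  _  = source-final v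
      inTree : ∀ v → T (tree (final′ v))
      inTree v with v ≟ v₀
      ... | yes _  = te
      ... | no  v≢ = final-inTree v≢
      leaves : ∃ λ i → ¬ T (tree (final′ (iterate (source ∘ along ∘ final′) v₀ i)))
      leaves = leavesTree tree arborescence final′ source-final′ v₀

    tree-unique : (∀ {x y} → source x ≡ source y → proj₁ x ≡ proj₁ y) →
                  ∀ {e} → T (tree e) → final (source e) ≡ e
    tree-unique sameType {e} te
      with e′ , _ , unique ← IsArborescence.uniqueEdge arborescence e (root-not-inTree te ∘ ≈⇒source) =
      trans (sym (unique ( final-inTree (root-not-inTree te)
                         , sameType (source-final (source e))
                         , inj₁ (source⇒≈ (source-final (source e))))))
            (unique (te , refl , inj₁ ≈-refl))

-- Tours of constellations

iterate-inverse : ∀ {A : Set} {f g : A → A} → (∀ x → g (f x) ≡ x) →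
                  ∀ m {x y} → iterate f x m ≡ y → iterate g y m ≡ x
iterate-inverse inv zero    eq = sym eq
iterate-inverse {f = f} {g} inv (suc m) {x} {y} eq =
  trans (iterate-suc g y m) (trans (cong g (iterate-inverse inv m eq)) (inv x))

module _ {E V : Set} (_≟_ : DecidableEquality V) (S S′ : Tour E V) where
  private
    module S  = Tour S
    module S′ = Tour S′
    open Exits _≟_ S  using (LastExit; here; there; lastExit; lastExit-spec; lastExit-here; lastExit-there; previous)
    module X′ = Exits _≟_ S′

  module _ (σ : E → E) (source-σ : ∀ x → S′.source (σ x) ≡ S.source x) where

    module _ (σ∘τ : ∀ x → σ (S.τ x) ≡ S′.τ (σ x)) where

      σ∘κ : ∀ x → σ (S.κ x) ≡ S′.κ (σ x)
      σ∘κ x = trans (sym (S′.κ∘τ _)) (cong S′.κ (trans (sym (σ∘τ _)) (cong σ (S.τ∘κ x))))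

      LastExit-natural : ∀ {z v y} → LastExit z v y → X′.LastExit (σ z) v (σ y)
      LastExit-natural {z} (here p) = subst (X′.LastExit (σ z) _) (sym (σ∘κ z))
        (X′.here (trans (cong S′.source (sym (σ∘κ z))) (trans (source-σ _) p)))
      LastExit-natural {z} (there ¬p l) = X′.there
        (¬p ∘ trans (sym (source-σ _)) ∘ trans (cong S′.source (σ∘κ z)))
        (subst (λ z → X′.LastExit z _ _) (σ∘κ z) (LastExit-natural l))

      lastExit-natural : ∀ z v → σ (lastExit z v) ≡ X′.lastExit (σ z) v
      lastExit-natural z v = sym (X′.LastExit⇒lastExit (LastExit-natural (lastExit-spec z v)))

      previous-natural : ∀ z → σ (previous z) ≡ X′.previous (σ z)
      previous-natural z = trans (lastExit-natural z _) (cong (X′.lastExit (σ z)) (sym (source-σ z)))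

    -- The successor τ z is the arc from the end of z whose predecessor in the
    -- rotor order is the last exit before τ z, which the past determines.
    module _ (ν : E → E) (σ∘ν : ∀ x → σ (ν x) ≡ ν (σ x))
             (source-τ : ∀ x → S.source (S.τ x) ≡ S.source (ν x))
             (source-τ′ : ∀ x → S′.source (S′.τ x) ≡ S′.source (ν x))
             (σ-root : σ S.root ≡ S′.root)
             (σ-lastExit : ∀ v → σ (lastExit S.root v) ≡ X′.lastExit S′.root v)
             (σ-previous : ∀ x → σ (previous x) ≡ X′.previous (σ x)) where

      private
        Agree : E → Set
        Agree z = ∀ v → σ (lastExit z v) ≡ X′.lastExit (σ z) v

        module _ {z : E} (agree : Agree z) where

          agree-next : ∀ v → σ (lastExit (S.τ z) v) ≡ X′.lastExit (S′.τ (σ z)) v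
          agree-next v with S.source z ≟ v
          ... | yes refl = trans (cong σ (lastExit-here z))
                  (sym (trans (cong (X′.lastExit _) (sym (source-σ z))) (X′.lastExit-here (σ z))))
          ... | no ¬p = trans (cong σ (lastExit-there ¬p))
                  (trans (agree v) (sym (X′.lastExit-there (¬p ∘ trans (sym (source-σ z))))))

          commute-next : σ (S.τ z) ≡ S′.τ (σ z)
          commute-next = X′.previous-injective (begin
            X′.previous (σ (S.τ z))                       ≡⟨ σ-previous _ ⟨
            σ (lastExit (S.τ z) (S.source (S.τ z)))       ≡⟨ agree-next _ ⟩
            X′.lastExit (S′.τ (σ z)) (S.source (S.τ z))   ≡⟨ cong (X′.lastExit _) (begin
              S.source (S.τ z)                              ≡⟨ source-τ z ⟩
              S.source (ν z)                                ≡⟨ source-σ (ν z) ⟨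
              S′.source (σ (ν z))                           ≡⟨ cong S′.source (σ∘ν z) ⟩
              S′.source (ν (σ z))                           ≡⟨ source-τ′ (σ z) ⟨
              S′.source (S′.τ (σ z))                        ∎) ⟩
            X′.previous (S′.τ (σ z))                      ∎)
            where open ≡-Reasoning

        agree-iterate : ∀ m {z} → Agree z → Agree (iterate S.τ z m)
        agree-iterate zero    agree = agree
        agree-iterate (suc m) agree = agree-iterate m
          (λ v → trans (agree-next agree v) (cong (λ z → X′.lastExit z v) (sym (commute-next agree))))

      τ-determined : ∀ x → σ (S.τ x) ≡ S′.τ (σ x)
      -- The hypotheses give agreement at the root, and every `x` is met going forward from there.
      τ-determined x with m , eq ← S.orbit x S.root =
        commute-next (subst Agree (iterate-inverse S.τ∘κ (suc m) eq)
          (agree-iterate (suc m) (λ v → trans (σ-lastExit v) (cong (λ z → X′.lastExit z v) (sym σ-root)))))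

module Fibrewise {k n} (F : Arc k n → Arc k n) (F-injective : Injective _≡_ _≡_ F)
                 (F-type : ∀ x → proj₁ (F x) ≡ proj₁ x) where

  private
    onType : Fin k → Fin n → Fin n
    onType t h = proj₂ (F (t , h))

    onType-spec : ∀ t h → F (t , h) ≡ (t , onType t h)
    onType-spec t h = cong (_, onType t h) (F-type (t , h))

    onType-injective : ∀ t → Injective _≡_ _≡_ (onType t)
    onType-injective t {x} {y} eq = ,-injectiveʳ (F-injective
      (trans (onType-spec t x) (trans (cong (t ,_) eq) (sym (onType-spec t y)))))

  open FiniteSet (Fin._≟_ {n}) (λ h → h) (λ eq → eq)

  abstract
    fibre : Fin k → Permutation′ n
    fibre t = Perm.permutation (onType t) (inverse (onType-injective t))
      (f∘inverse (onType-injective t)) (inverse∘f (onType-injective t))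

    fibre-spec : ∀ t h → F (t , h) ≡ (t , fibre t ⟨$⟩ʳ h)
    fibre-spec = onType-spec

  private
    SameCycle : Arc k n → Arc k n → Set
    SameCycle (t , x) (u , y) = t ≡ u × Setoid._≈_ (cycles (fibre t)) x y

    edge : ∀ {x y} → F x ≡ y → SameCycle x y
    edge {t , x} {u , y} eq with refl ← trans (sym (fibre-spec t x)) eq = refl , EqC.return refl

  EqClosure⇒cycles : ∀ {t x y} → EqClosure (λ x y → F x ≡ y) (t , x) (t , y) →
                     Setoid._≈_ (cycles (fibre t)) x y
  EqClosure⇒cycles path = proj₂ (EqC.fold {S = SameCycle}
    (record
      { refl  = refl , EqC.reflexive _
      ; sym   = λ { (refl , p) → refl , EqC.symmetric _ p }
      ; trans = λ { (refl , p) (refl , q) → refl , EqC.transitive _ p q } })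
    edge
    path)

-- White faces as orbits of the turning map

module Turning {k n} (π : Fin k → Permutation′ n) where

  -- The boundary walk of a white face: at the far end of the edge of type t of `h`, it passes to
  -- the hyperedge preceding `h` counterclockwise and takes the edge of type t + 1 there.
  turn : Arc k n → Arc k n
  turn (t , h) = nextType t , π (nextType t) ⟨$⟩ˡ h

  turn-unique : ∀ {t h u g} → (u , π u ⟨$⟩ʳ g) ≡ along (t , h) → turn (t , h) ≡ (u , g)
  turn-unique {u = u} refl = cong (u ,_) (Perm.inverseˡ (π u))

  private
    ⟨$⟩ˡ-injective : ∀ t → Injective _≡_ _≡_ (π t ⟨$⟩ˡ_)
    ⟨$⟩ˡ-injective t eq = trans (sym (Perm.inverseʳ (π t))) (trans (cong (π t ⟨$⟩ʳ_) eq) (Perm.inverseʳ (π t)))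

  turn-injective : Injective _≡_ _≡_ turn
  turn-injective {t , x} {u , y} eq with refl ← nextType-injective (,-injectiveˡ eq) =
    cong (t ,_) (⟨$⟩ˡ-injective (nextType t) (,-injectiveʳ eq))

  open FiniteSet (_≟ᵃ_ {k} {n}) arcCode arcCode-injective public

  SameOrbit : Arc k n → Arc k n → Set
  SameOrbit x y = ∃ λ m → iterate turn x m ≡ y

  orbit-trans : ∀ {x y z} → SameOrbit x y → SameOrbit y z → SameOrbit x z
  orbit-trans {x} (m , refl) (m′ , refl) = m + m′ , iterate-+ turn x m m′

  orbit-sym : ∀ {x y} → SameOrbit x y → SameOrbit y x
  orbit-sym (m , eq) = iterate-sym turn-injective m eq

  orbit⇒transitive : (∀ x y → SameOrbit x y) → Fin k →
                     ∀ x y → EqClosure (λ x y → ∃ λ t → π t ⟨$⟩ʳ x ≡ y) x y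
  orbit⇒transitive connected t x y with m , eq ← connected (t , x) (t , y) =
    subst (EqClosure _ x) (cong proj₂ eq) (go m (t , x))
    where
    go : ∀ m e → EqClosure (λ x y → ∃ λ t → π t ⟨$⟩ʳ x ≡ y) (proj₂ e) (proj₂ (iterate turn e m))
    go zero    e       = EqC.reflexive _
    go (suc m) (t , h) = EqC.transitive _
      (EqC.symmetric _ (EqC.return (nextType t , Perm.inverseʳ (π (nextType t)))))
      (go m (turn (t , h)))

module WhiteFaces {k n} (π : Fin (suc k) → Permutation′ n) where
  open Turning π

  private
    -- Each turn cancels the outermost factor of the product, so one round through all types undoes
    -- `product π`. A block of consecutive types is allowed so that the induction can follow the
    -- fold.
    turn-chain : ∀ m (f : Fin m → Fin (suc k)) a → (∀ j → f j ≡ (suc a + toℕ j) mod suc k) → ∀ h →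
      iterate turn (a mod suc k , product (π ∘ f) ⟨$⟩ʳ h) m ≡ ((a + m) mod suc k , h)
    turn-chain zero    f a eq h = cong (λ a → a mod suc k , h) (sym (+-identityʳ a))
    turn-chain (suc m) f a eq h = begin
      iterate turn (turn (a mod suc k , π (f zero) ⟨$⟩ʳ h′)) m
        ≡⟨ cong (λ x → iterate turn x m) step ⟩
      iterate turn (suc a mod suc k , h′) m
        ≡⟨ turn-chain m (f ∘ suc) (suc a) (λ j → trans (eq (suc j))
             (cong (_mod suc k) (+-suc (suc a) (toℕ j)))) h ⟩
      ((suc a + m) mod suc k , h)
        ≡⟨ cong (λ a → a mod suc k , h) (sym (+-suc a m)) ⟩
      ((a + suc m) mod suc k , h) ∎
      where
      open ≡-Reasoning
      h′ : Fin n
      h′ = product (π ∘ f ∘ suc) ⟨$⟩ʳ h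
      next≡ : nextType (a mod suc k) ≡ f zero
      next≡ = trans (nextType-mod a) (sym (trans (eq zero) (cong (_mod suc k) (+-identityʳ (suc a)))))
      step : turn (a mod suc k , π (f zero) ⟨$⟩ʳ h′) ≡ (suc a mod suc k , h′)
      step = trans (cong (λ t → t , π t ⟨$⟩ˡ (π (f zero) ⟨$⟩ʳ h′)) next≡)
                   (cong₂ _,_ (trans (sym next≡) (nextType-mod a)) (Perm.inverseˡ (π (f zero))))

    k-mod : k mod suc k ≡ fromℕ k
    k-mod = trans (cong (_mod suc k) (sym (Fin.toℕ-fromℕ k))) (toℕ-mod-inverse (fromℕ k))

    last : Fin n → Arc (suc k) n
    last h = fromℕ k , h

    turn-face : ∀ h → iterate turn (last (product π ⟨$⟩ʳ h)) (suc k) ≡ last h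
    turn-face h = begin
      iterate turn (last (product π ⟨$⟩ʳ h)) (suc k)
        ≡⟨ cong (λ t → iterate turn (t , product π ⟨$⟩ʳ h) (suc k)) k-mod ⟨
      iterate turn (k mod suc k , product π ⟨$⟩ʳ h) (suc k)
        ≡⟨ turn-chain (suc k) (λ t → t) k indices h ⟩
      ((k + suc k) mod suc k , h)
        ≡⟨ cong (_, h) (trans (mod-cong (k + suc k) k (suc k) ([m+n]%n≡m%n k (suc k))) k-mod) ⟩
      last h ∎
      where
      open ≡-Reasoning
      indices : ∀ j → j ≡ (suc k + toℕ j) mod suc k
      indices j = sym (trans (mod-cong (suc k + toℕ j) (toℕ j) (suc k)
        (trans (cong (_% suc k) (+-comm (suc k) (toℕ j))) ([m+n]%n≡m%n (toℕ j) (suc k))))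
        (toℕ-mod-inverse j))

    iterate-type : ∀ m t h → proj₁ (iterate turn (t , h) m) ≡ (toℕ t + m) mod suc k
    iterate-type zero    t h = sym (trans (cong (_mod suc k) (+-identityʳ (toℕ t))) (toℕ-mod-inverse t))
    iterate-type (suc m) t h = trans (iterate-type m (nextType t) _)
      (mod-cong (toℕ (nextType t) + m) (toℕ t + suc m) (suc k) (begin
        (toℕ (nextType t) + m) % suc k
          ≡⟨ cong (λ i → (i + m) % suc k) (toℕ-mod (suc (toℕ t)) (suc k)) ⟩
        (suc (toℕ t) % suc k + m) % suc k
          ≡⟨ %-distribˡ-+ (suc (toℕ t) % suc k) m (suc k) ⟩
        (suc (toℕ t) % suc k % suc k + m % suc k) % suc k
          ≡⟨ cong (λ i → (i + m % suc k) % suc k) (m%n%n≡m%n (suc (toℕ t)) (suc k)) ⟩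
        (suc (toℕ t) % suc k + m % suc k) % suc k
          ≡⟨ %-distribˡ-+ (suc (toℕ t)) m (suc k) ⟨
        (suc (toℕ t) + m) % suc k
          ≡⟨ cong (_% suc k) (+-suc (toℕ t) m) ⟨
        (toℕ t + suc m) % suc k ∎))
      where open ≡-Reasoning

    orbit-last : ∀ x → ∃ λ h → SameOrbit x (last h)
    orbit-last (t , h) = proj₂ y , k ∸ toℕ t , cong (_, proj₂ y)
      (trans (iterate-type (k ∸ toℕ t) t h)
        (trans (cong (_mod suc k) (m+[n∸m]≡n (s≤s⁻¹ (Fin.toℕ<n t)))) k-mod))
      where
      y : Arc (suc k) n
      y = iterate turn (t , h) (k ∸ toℕ t)

    Faces : Fin n → Fin n → Set
    Faces = EqClosure (λ x y → product π ⟨$⟩ʳ x ≡ y)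

    faces-orbit : ∀ {g h} → Faces g h → SameOrbit (last g) (last h)
    faces-orbit = EqC.gfold {S = SameOrbit}
      (record
        { refl  = 0 , refl
        ; sym   = λ {x} {y} → orbit-sym {x} {y}
        ; trans = λ {x} {y} {z} → orbit-trans {x} {y} {z} })
      last (λ { {x} refl → orbit-sym (suc k , turn-face x) })

    multiple-faces : ∀ q h → ∃ λ g → iterate turn (last h) (q * suc k) ≡ last g × Faces h g
    multiple-faces zero    h = h , refl , EqC.reflexive _
    multiple-faces (suc q) h with g , eq , r ← multiple-faces q (product π ⟨$⟩ˡ h) = g ,
      trans (iterate-+ turn (last h) (suc k) (q * suc k))
        (trans (cong (λ x → iterate turn x (q * suc k))
          (trans (cong (λ h → iterate turn (last h) (suc k)) (sym (Perm.inverseʳ (product π))))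
            (turn-face _))) eq) ,
      EqC.transitive _ (EqC.symmetric _ (EqC.return (Perm.inverseʳ (product π)))) r

  singleFace⇒singleOrbit : (∃ λ f → ∀ g → Faces f g) → ∀ x y → SameOrbit x y
  singleFace⇒singleOrbit (f , all) x y with orbit-last x | orbit-last y
  ... | g , p | h , q = orbit-trans p (orbit-trans
          (faces-orbit (EqC.transitive _ (EqC.symmetric _ (all g)) (all h))) (orbit-sym q))

  singleOrbit⇒singleFace : (∀ x y → SameOrbit x y) → ∀ g h → Faces g h
  singleOrbit⇒singleFace connected g h with m , eq ← connected (last g) (last h)
    -- A turn advances the type by one, so two arcs of the last type are a multiple of `suc k` turns
    -- apart.
    with g′ , eq′ , r ← multiple-faces (m / suc k) g =
    subst (Faces g) (,-injectiveʳ (trans (sym eq′) (trans (cong (iterate turn (last g)) (sym m≡)) eq))) r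
    where
    open ≡-Reasoning
    remainder : m % suc k ≡ 0
    remainder = begin
      m % suc k                        ≡⟨ [m+n]%n≡m%n m (suc k) ⟨
      (m + suc k) % suc k              ≡⟨ cong (_% suc k) (+-comm m (suc k)) ⟩
      (1 + (k + m)) % suc k            ≡⟨ %-distribˡ-+ 1 (k + m) (suc k) ⟩
      (1 % suc k + (k + m) % suc k) % suc k  ≡⟨ cong (λ i → (1 % suc k + i) % suc k) lastPosition ⟩
      (1 % suc k + k % suc k) % suc k  ≡⟨ %-distribˡ-+ 1 k (suc k) ⟨
      suc k % suc k                    ≡⟨ n%n≡0 (suc k) ⟩
      0                                ∎
      where
      lastPosition : (k + m) % suc k ≡ k % suc k
      lastPosition = begin
        (k + m) % suc k                    ≡⟨ toℕ-mod (k + m) (suc k) ⟨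
        toℕ ((k + m) mod suc k)            ≡⟨ cong (λ i → toℕ ((i + m) mod suc k)) (Fin.toℕ-fromℕ k) ⟨
        toℕ ((toℕ (fromℕ k) + m) mod suc k) ≡⟨ cong toℕ (iterate-type m (fromℕ k) g) ⟨
        toℕ (proj₁ (iterate turn (last g) m)) ≡⟨ cong (toℕ ∘ proj₁) eq ⟩
        toℕ (fromℕ k)                      ≡⟨ cong toℕ k-mod ⟨
        toℕ (k mod suc k)                  ≡⟨ toℕ-mod k (suc k) ⟩
        k % suc k                          ∎
    m≡ : m ≡ (m / suc k) * suc k
    m≡ = trans (m≡m%n+[m/n]*n m (suc k)) (cong (_+ (m / suc k) * suc k) remainder)

-- The bijection

TypedLabel-injective : ∀ {k} {p : Fin k → ℕ} {t} {i j : Fin (p t)} →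
                       _≡_ {A = TypedLabel p} (t , i) (t , j) → i ≡ j
TypedLabel-injective refl = refl

≅-of-≗ : ∀ {k n} {C D : RootedConstellation k n} →
  (∀ t h → RootedConstellation.π C t ⟨$⟩ʳ h ≡ RootedConstellation.π D t ⟨$⟩ʳ h) →
  RootedConstellation.root C ≡ RootedConstellation.root D → C ≅ D
≅-of-≗ eq root-eq = record { relabel = Perm.id ; π-comm = eq ; root-eq = root-eq }

module _ {k n : ℕ} {p : Fin (2+ k) → ℕ} where

  private
    E : Set
    E = Arc (2+ k) n

    V : Set
    V = TypedLabel p

  -- From a colored cactus to a tree-rooted constellation

  module CactusTour (C : ColoredCactus n p) where
    open ColoredCactus C hiding (source)
    open Turning π using (turn; turn-injective; SameOrbit; inverse; f∘inverse; inverse∘f)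

    source : E → V
    source (t , h) = t , color t h

    color-π : ∀ t h → color t (π t ⟨$⟩ʳ h) ≡ color t h
    color-π t h = sym (Surjection.cong (coloring t) (EqC.return refl))

    source-turn : ∀ x → source (turn x) ≡ source (along x)
    source-turn (t , h) = cong (nextType t ,_)
      (trans (sym (color-π (nextType t) _)) (cong (color (nextType t)) (Perm.inverseʳ (π (nextType t)))))

    private
      κ : E → E
      κ = inverse turn-injective

      connected : ∀ x y → SameOrbit x y
      connected = WhiteFaces.singleFace⇒singleOrbit π singleWhiteFace

      arc : V → E
      arc (t , i) = t , proj₁ (Surjection.strictlySurjective (coloring t) i)

    tour : Tour E V
    tour = record
      { source = source ; τ = turn ; κ = κ
      ; τ∘κ = f∘inverse turn-injective ; κ∘τ = inverse∘f turn-injective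
      ; root = rootVertex
      ; orbit = λ z x → let m , eq = connected x (κ z) in
          m , iterate-inverse (inverse∘f turn-injective) m eq
      ; arc = arc
      ; source-arc = λ (t , i) → cong (t ,_) (proj₂ (Surjection.strictlySurjective (coloring t) i))
      }

    v₀ : V
    v₀ = source rootVertex

    open Exits _≟ˡ_ tour public

    open Fibrewise previous previous-injective (λ x → cong proj₁ (source-previous x)) public
      renaming (fibre to previousAt; fibre-spec to previousAt-spec)

    previousAt-color : ∀ t h → color t (previousAt t ⟨$⟩ʳ h) ≡ color t h
    previousAt-color t h = TypedLabel-injective
      (trans (cong source (sym (previousAt-spec t h))) (source-previous (t , h)))

    cycle⇒color : ∀ {t x y} → Setoid._≈_ (cycles (previousAt t)) x y → color t x ≡ color t y
    cycle⇒color {t} = EqC.gfold isEquivalence (color t) (λ { refl → sym (previousAt-color t _) })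

    color⇒cycle : ∀ {t x y} → color t x ≡ color t y → Setoid._≈_ (cycles (previousAt t)) x y
    color⇒cycle {t} eq = EqClosure⇒cycles (sameSource⇒~ (cong (t ,_) eq))

    private
      Linked : Fin n → Fin n → Set
      Linked = EqClosure (λ x y → ∃ λ t → previousAt t ⟨$⟩ʳ x ≡ y)

      -- A turn changes the hyperedge around a vertex of the cactus, which keeps the color, so the
      -- two hyperedges share a vertex after gluing as well.
      linked-iterate : ∀ m x → Linked (proj₂ x) (proj₂ (iterate turn x m))
      linked-iterate zero    x       = EqC.reflexive _
      linked-iterate (suc m) (t , h) = EqC.transitive _
        (EqC.map (nextType t ,_) (color⇒cycle (TypedLabel-injective (sym (source-turn (t , h))))))
        (linked-iterate m (turn (t , h)))

      linked : ∀ x y → Linked x y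
      linked x y with m , eq ← connected (zero , x) (zero , y) =
        subst (Linked x) (cong proj₂ eq) (linked-iterate m (zero , x))

    rootedConstellation : RootedConstellation (2+ k) n
    rootedConstellation = record
      { constellation = record { π = previousAt ; transitive = linked } ; root = root }

    open RootedConstellation rootedConstellation using () renaming (_≈ᵥ_ to _≈′_)

    ≈⇒source : ∀ {x y} → x ≈′ y → source x ≡ source y
    ≈⇒source {t , _} (refl , p) = cong (t ,_) (cycle⇒color p)

    source⇒≈ : ∀ {x y} → source x ≡ source y → x ≈′ y
    source⇒≈ {t , _} {u , _} eq with refl ← ,-injectiveˡ eq = refl , color⇒cycle (TypedLabel-injective eq)

    isTreeArc? : ∀ x → Dec (source x ≢ v₀ × lastExit rootVertex (source x) ≡ x)
    isTreeArc? x = ¬? (source x ≟ˡ v₀) ×-dec (lastExit rootVertex (source x) ≟ᵃ x)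

    treeArcs : E → Bool
    treeArcs x = ⌊ isTreeArc? x ⌋

    treeArcs-arborescence : RootedConstellation.IsArborescence rootedConstellation rootVertex treeArcs
    treeArcs-arborescence =
      Arborescence.isArborescence (RootedConstellation.constellation rootedConstellation) rootVertex
        _≟ˡ_ source ≈⇒source source⇒≈
        (lastExit rootVertex) (source-lastExit rootVertex) reaches
        treeArcs (λ {x} → toWitness {a? = isTreeArc? x})
        (λ {v} v≢ → fromWitness (subst (_≢ v₀) (sym (source-lastExit rootVertex v)) v≢
                              , cong (lastExit rootVertex) (source-lastExit rootVertex v)))
        (cong proj₁)
      where
      reaches : ∀ v → Reaches (source ∘ along ∘ lastExit rootVertex) v₀ v
      reaches v = Reaches-cong (λ v → source-turn (lastExit rootVertex v))
        (lastExits-reach-root v)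

    treeRooted : TreeRooted n p
    treeRooted = record
      { rooted = rootedConstellation
      ; tree = treeArcs
      ; isArborescence = treeArcs-arborescence
      ; labelling = λ t → record
        { to = color t
        ; cong = cycle⇒color
        ; bijective = color⇒cycle , λ i → let x , eq = Surjection.strictlySurjective (coloring t) i in
            x , λ path → trans (cycle⇒color path) eq
        }
      }

  -- From a tour to a colored cactus

  module TourCactus
    (W : Tour E V) (c : ∀ t → Fin n → Fin (p t)) (root : Fin n)
    (source-W : ∀ x → Tour.source W x ≡ (proj₁ x , c (proj₁ x) (proj₂ x)))
    (source-τ : ∀ x → Tour.source W (Tour.τ W x) ≡ Tour.source W (along x))
    where

    open Tour W using (τ; κ; τ∘κ; κ∘τ; orbit; arc; source-arc)

    private
      source : E → V
      source = Tour.source W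

      source⇒type : ∀ {x y} → source x ≡ source y → proj₁ x ≡ proj₁ y
      source⇒type eq = cong proj₁ (trans (sym (source-W _)) (trans eq (source-W _)))

      source⇒color : ∀ {t h g} → source (t , h) ≡ source (t , g) → c t h ≡ c t g
      source⇒color eq = TypedLabel-injective (trans (sym (source-W _)) (trans eq (source-W _)))

      -- The rotation forced by the tour: if the face walk is to turn from `κ x` into `x`, the
      -- permutation at the source of `x` must send the hyperedge of `x` to that of `κ x`.
      back : E → E
      back x = along (κ x)

      back-injective : Injective _≡_ _≡_ back
      back-injective eq = trans (sym (τ∘κ _)) (trans (cong τ (along-injective eq)) (τ∘κ _))

      source-back : ∀ x → source (back x) ≡ source x
      source-back x = trans (sym (source-τ (κ x))) (cong source (τ∘κ x))

    open Fibrewise back back-injective (λ x → source⇒type (source-back x)) public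
      renaming (fibre to backAt; fibre-spec to backAt-spec)

    open Turning backAt using (turn; turn-unique; SameOrbit; orbit⇒transitive)

    turn≡τ : ∀ x → turn x ≡ τ x
    turn≡τ x = turn-unique {proj₁ x} {proj₂ x} {proj₁ (τ x)} {proj₂ (τ x)}
      (trans (sym (backAt-spec (proj₁ (τ x)) (proj₂ (τ x)))) (cong along (κ∘τ x)))

    private
      iterate-turn : ∀ m x → iterate turn x m ≡ iterate τ x m
      iterate-turn zero    x = refl
      iterate-turn (suc m) x = trans (cong (λ x → iterate turn x m) (turn≡τ x)) (iterate-turn m (τ x))

      connected : ∀ x y → SameOrbit x y
      connected x y with m , eq ← orbit y x = suc m ,
        trans (iterate-turn (suc m) x) (iterate-inverse τ∘κ (suc m) eq)

      backAt-color : ∀ t h → c t (backAt t ⟨$⟩ʳ h) ≡ c t h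
      backAt-color t h = source⇒color (trans (cong source (sym (backAt-spec t h))) (source-back (t , h)))

      c-cong : ∀ {t x y} → Setoid._≈_ (cycles (backAt t)) x y → c t x ≡ c t y
      c-cong {t} = EqC.gfold isEquivalence (c t) (λ { refl → sym (backAt-color t _) })

      c-surjective : ∀ t i → ∃ λ h → c t h ≡ i
      c-surjective t i with arc (t , i) in eq
      ... | u , h with refl ← trans (sym (source-W (u , h))) (trans (cong source (sym eq)) (source-arc (t , i))) =
        h , refl

    cactus : ColoredCactus n p
    cactus = record
      { rooted = record
        { constellation = record { π = backAt ; transitive = orbit⇒transitive connected zero }
        ; root = root }
      ; singleWhiteFace = root , WhiteFaces.singleOrbit⇒singleFace backAt connected root
      ; coloring = λ t → record
        { to = c t
        ; cong = c-cong
        ; surjective = λ i → let x , eq = c-surjective t i in x , λ path → trans (c-cong path) eq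
        }
      }

    private
      module C = CactusTour cactus

    cactus-lastExit : ∀ z v → C.lastExit z v ≡ Exits.lastExit _≟ˡ_ W z v
    cactus-lastExit = lastExit-natural _≟ˡ_ C.tour W (λ x → x) source-W turn≡τ

    cactus-previous : ∀ x → C.previous x ≡ Exits.previous _≟ˡ_ W x
    cactus-previous = previous-natural _≟ˡ_ C.tour W (λ x → x) source-W turn≡τ

  -- From a tree-rooted constellation to a tour

  module TreeTour (D : TreeRooted n p) where
    open TreeRooted D hiding (source)

    source : E → V
    source (t , h) = t , label t h

    private
      turnAt turnAt⁻¹ : E → E
      turnAt   (t , h) = t , π t ⟨$⟩ʳ h
      turnAt⁻¹ (t , h) = t , π t ⟨$⟩ˡ h

      turnAt∘turnAt⁻¹ : ∀ x → turnAt (turnAt⁻¹ x) ≡ x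
      turnAt∘turnAt⁻¹ (t , h) = cong (t ,_) (Perm.inverseʳ (π t))

      turnAt⁻¹∘turnAt : ∀ x → turnAt⁻¹ (turnAt x) ≡ x
      turnAt⁻¹∘turnAt (t , h) = cong (t ,_) (Perm.inverseˡ (π t))

      turnAt-injective : Injective _≡_ _≡_ turnAt
      turnAt-injective eq =
        trans (sym (turnAt⁻¹∘turnAt _)) (trans (cong turnAt⁻¹ eq) (turnAt⁻¹∘turnAt _))

      ≈⇒source : ∀ {x y} → x ≈ᵥ y → source x ≡ source y
      ≈⇒source {t , _} (refl , path) = cong (t ,_) (Bijection.cong (labelling t) path)

      source⇒≈ : ∀ {x y} → source x ≡ source y → x ≈ᵥ y
      source⇒≈ {t , _} eq with refl ← ,-injectiveˡ eq =
        refl , Bijection.injective (labelling t) (TypedLabel-injective eq)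

      source-turnAt : ∀ x → source (turnAt x) ≡ source x
      source-turnAt (t , h) = sym (≈⇒source (refl , EqC.return refl))

      open FiniteSet (_≟ᵃ_ {2+ k} {n}) arcCode arcCode-injective using (closure⇒iterate)

      fibre-cyclic : ∀ {x y} → source x ≡ source y → ∃ λ m → iterate turnAt x m ≡ y
      fibre-cyclic {t , _} eq with refl , path ← source⇒≈ eq =
        closure⇒iterate turnAt-injective (EqC.gmap (t ,_) (cong (t ,_)) path)

    v₀ : V
    v₀ = source rootVertex

    private
      open Arborescence constellation rootVertex _≟ˡ_ source ≈⇒source source⇒≈ using
        (arborescence-reaches; root-not-inTree; tree-unique)

      arc : V → E
      arc (t , i) = t , proj₁ (Bijection.strictlySurjective (labelling t) i)

      source-arc : ∀ v → source (arc v) ≡ v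
      source-arc (t , i) = cong (t ,_) (proj₂ (Bijection.strictlySurjective (labelling t) i))

      -- The root vertex has no tree arc. Its final arc is chosen so that the next one in the order,
      -- with which the walk begins, is the root arc.
      TreeArc : V → E → Set
      TreeArc v e = source e ≡ v × (v ≢ v₀ → T (tree e)) × (v ≡ v₀ → e ≡ turnAt rootVertex)

      treeArc : ∀ v → ∃ (TreeArc v)
      treeArc v with v ≟ˡ v₀
      ... | yes refl = turnAt rootVertex , source-turnAt rootVertex , contradiction refl , λ _ → refl
      ... | no v≢ with IsArborescence.uniqueEdge isArborescence (arc v)
                         (v≢ ∘ trans (sym (source-arc v)) ∘ ≈⇒source)
      ...   | e , (te , _ , inj₁ p) , _ =
              e , trans (≈⇒source p) (source-arc v) , (λ _ → te) , λ v≡ → contradiction v≡ v≢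
      ...   | e , (te , same , inj₂ (q , _)) , _ = contradiction (trans q (sym same)) (nextType≢ (proj₁ e))

    final : V → E
    final v = proj₁ (treeArc v)

    private
      source-final : ∀ v → source (final v) ≡ v
      source-final v = proj₁ (proj₂ (treeArc v))

      final-inTree : ∀ {v} → v ≢ v₀ → T (tree (final v))
      final-inTree {v} = proj₁ (proj₂ (proj₂ (treeArc v)))

      final-root : turnAt⁻¹ (final v₀) ≡ rootVertex
      final-root = trans (cong turnAt⁻¹ (proj₂ (proj₂ (proj₂ (treeArc v₀))) refl)) (turnAt⁻¹∘turnAt rootVertex)

      rotorTour = RotorWalk.rotorTour _≟ᵃ_ _≟ˡ_ arcCode arcCode-injective
        source along along-injective turnAt turnAt⁻¹ turnAt∘turnAt⁻¹ turnAt⁻¹∘turnAt source-turnAt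
        fibre-cyclic final source-final v₀
        (arborescence-reaches tree isArborescence final source-final final-inTree)

      W : Tour E V
      W = proj₁ rotorTour

      source-W : ∀ x → Tour.source W x ≡ source x
      source-W = proj₁ (proj₂ rotorTour)

      source-τ : ∀ x → Tour.source W (Tour.τ W x) ≡ Tour.source W (along x)
      source-τ x = trans (source-W _) (trans (proj₁ (proj₂ (proj₂ rotorTour)) x) (sym (source-W _)))

    open TourCactus W label root source-W source-τ public

    private
      module C = CactusTour cactus

      previous≡ : ∀ x → C.previous x ≡ turnAt x
      previous≡ x = trans (cactus-previous x) (proj₂ (proj₂ (proj₂ (proj₂ rotorTour))) x)

      lastExit≡ : ∀ v → C.lastExit rootVertex v ≡ final v
      lastExit≡ v = trans (cactus-lastExit rootVertex v)
        (trans (cong (λ z → Exits.lastExit _≟ˡ_ W z v) (sym final-root))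
               (proj₁ (proj₂ (proj₂ (proj₂ rotorTour))) v))

    treeRooted-cactus : Setoid._≈_ (treeRootedConstellations n p) C.treeRooted D
    treeRooted-cactus =
      ≅-of-≗ (λ t h → ,-injectiveʳ (trans (sym (C.previousAt-spec t h)) (previous≡ (t , h)))) refl
      , (λ _ _ → refl)
      , λ t h → trans (isYes≗does (C.isTreeArc? (t , h)))
          (does-⇔ (mk⇔ inTree isFinal) (C.isTreeArc? (t , h)) (T? (tree (t , h))))
      where
      inTree : ∀ {x} → source x ≢ v₀ × C.lastExit rootVertex (source x) ≡ x → T (tree x)
      inTree (x≢ , eq) = subst (T ∘ tree) (trans (sym (lastExit≡ _)) eq) (final-inTree x≢)
      isFinal : ∀ {x} → T (tree x) → source x ≢ v₀ × C.lastExit rootVertex (source x) ≡ x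
      isFinal tx =
        root-not-inTree tree isArborescence final source-final final-inTree tx ,
        trans (lastExit≡ _)
          (tree-unique tree isArborescence final source-final final-inTree (cong proj₁) tx)

  -- Isomorphism classes

  onArcs : Permutation′ n → E → E
  onArcs σ (t , h) = t , σ ⟨$⟩ʳ h

  Φ : ColoredCactus n p → TreeRooted n p
  Φ = CactusTour.treeRooted

  module _ {C D : ColoredCactus n p} where
    private
      module C = CactusTour C
      module D = CactusTour D
      πᶜ = ColoredCactus.π C
      πᴰ = ColoredCactus.π D

    Φ-cong : Setoid._≈_ (coloredCacti n p) C D → Setoid._≈_ (treeRootedConstellations n p) (Φ C) (Φ D)
    Φ-cong (i , colors) =
      record
        { relabel = relabel i
        ; π-comm  = λ t h → ,-injectiveʳ (begin
            σ (t , C.previousAt t ⟨$⟩ʳ h)  ≡⟨ cong σ (C.previousAt-spec t h) ⟨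
            σ (C.previous (t , h))         ≡⟨ previous-natural _≟ˡ_ C.tour D.tour σ source-σ σ-turn (t , h) ⟩
            D.previous (σ (t , h))         ≡⟨ D.previousAt-spec t (relabel i ⟨$⟩ʳ h) ⟩
            (t , D.previousAt t ⟨$⟩ʳ (relabel i ⟨$⟩ʳ h)) ∎)
        ; root-eq = _≅_.root-eq i
        }
      , colors
      , λ t h → trans (isYes≗does (C.isTreeArc? (t , h)))
          (trans (does-⇔ (mk⇔ forth back) (C.isTreeArc? (t , h)) (D.isTreeArc? (σ (t , h))))
                 (sym (isYes≗does (D.isTreeArc? (σ (t , h))))))
      where
      open ≡-Reasoning
      σ : E → E
      σ = onArcs (relabel i)
      σ-injective : Injective _≡_ _≡_ σ
      σ-injective {t , x} eq with refl ← ,-injectiveˡ eq = cong (t ,_)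
        (trans (sym (Perm.inverseˡ (relabel i)))
          (trans (cong (relabel i ⟨$⟩ˡ_) (,-injectiveʳ eq)) (Perm.inverseˡ (relabel i))))
      σ-root : σ (C.tour .Tour.root) ≡ D.tour .Tour.root
      σ-root = cong (lastType ,_) (_≅_.root-eq i)
      source-σ : ∀ x → D.source (σ x) ≡ C.source x
      source-σ (t , h) = cong (t ,_) (sym (colors t h))
      σ-turn : ∀ x → σ (Turning.turn πᶜ x) ≡ Turning.turn πᴰ (σ x)
      σ-turn (t , h) = cong (nextType t ,_) (begin
        relabel i ⟨$⟩ʳ (πᶜ u ⟨$⟩ˡ h)  ≡⟨ Perm.inverseˡ (πᴰ u) ⟨
        πᴰ u ⟨$⟩ˡ (πᴰ u ⟨$⟩ʳ (relabel i ⟨$⟩ʳ (πᶜ u ⟨$⟩ˡ h)))  ≡⟨ cong (πᴰ u ⟨$⟩ˡ_) (_≅_.π-comm i u _) ⟨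
        πᴰ u ⟨$⟩ˡ (relabel i ⟨$⟩ʳ (πᶜ u ⟨$⟩ʳ (πᶜ u ⟨$⟩ˡ h)))
          ≡⟨ cong (λ h → πᴰ u ⟨$⟩ˡ (relabel i ⟨$⟩ʳ h)) (Perm.inverseʳ (πᶜ u)) ⟩
        πᴰ u ⟨$⟩ˡ (relabel i ⟨$⟩ʳ h) ∎)
        where u = nextType t
      v₀≡ : C.v₀ ≡ D.v₀
      v₀≡ = trans (sym (source-σ _)) (cong D.source σ-root)
      lastExit≡ : ∀ x → σ (C.lastExit (C.tour .Tour.root) (C.source x)) ≡
                        D.lastExit (D.tour .Tour.root) (D.source (σ x))
      lastExit≡ x = trans (lastExit-natural _≟ˡ_ C.tour D.tour σ source-σ σ-turn _ _)
        (cong₂ D.lastExit σ-root (sym (source-σ x)))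
      forth : ∀ {x} → C.source x ≢ C.v₀ × C.lastExit (C.tour .Tour.root) (C.source x) ≡ x →
              D.source (σ x) ≢ D.v₀ × D.lastExit (D.tour .Tour.root) (D.source (σ x)) ≡ σ x
      forth {x} (x≢ , eq) =
        (λ eq′ → x≢ (trans (sym (source-σ x)) (trans eq′ (sym v₀≡)))) ,
        trans (sym (lastExit≡ x)) (cong σ eq)
      back : ∀ {x} → D.source (σ x) ≢ D.v₀ × D.lastExit (D.tour .Tour.root) (D.source (σ x)) ≡ σ x →
             C.source x ≢ C.v₀ × C.lastExit (C.tour .Tour.root) (C.source x) ≡ x
      back {x} (x≢ , eq) =
        (λ eq′ → x≢ (trans (source-σ x) (trans eq′ v₀≡))) ,
        σ-injective (trans (lastExit≡ x) eq)

    Φ-injective : Setoid._≈_ (treeRootedConstellations n p) (Φ C) (Φ D) → Setoid._≈_ (coloredCacti n p) C D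
    Φ-injective (i , colors , trees) =
      record { relabel = relabel i ; π-comm = π-comm ; root-eq = _≅_.root-eq i } , colors
      where
      open ≡-Reasoning
      σ : E → E
      σ = onArcs (relabel i)
      rootᶜ rootᴰ : E
      rootᶜ = C.tour .Tour.root
      rootᴰ = D.tour .Tour.root
      σ-root : σ rootᶜ ≡ rootᴰ
      σ-root = cong (lastType ,_) (_≅_.root-eq i)
      source-σ : ∀ x → D.source (σ x) ≡ C.source x
      source-σ (t , h) = cong (t ,_) (sym (colors t h))
      v₀≡ : C.v₀ ≡ D.v₀
      v₀≡ = trans (sym (source-σ _)) (cong D.source σ-root)
      σ-previous : ∀ x → σ (C.previous x) ≡ D.previous (σ x)
      σ-previous (t , h) = begin
        σ (C.previous (t , h))         ≡⟨ cong σ (C.previousAt-spec t h) ⟩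
        σ (t , C.previousAt t ⟨$⟩ʳ h)  ≡⟨ cong (t ,_) (_≅_.π-comm i t h) ⟩
        (t , D.previousAt t ⟨$⟩ʳ (relabel i ⟨$⟩ʳ h)) ≡⟨ D.previousAt-spec t (relabel i ⟨$⟩ʳ h) ⟨
        D.previous (σ (t , h))         ∎
      σ-lastExit : ∀ v → σ (C.lastExit rootᶜ v) ≡ D.lastExit rootᴰ v
      σ-lastExit v with v ≟ˡ C.v₀
      -- The tree says nothing about the root vertex, but its last exit before the root arc is
      -- `previous` of that arc, which the rotation system determines.
      ... | yes refl = trans (σ-previous rootᶜ) (trans (cong D.previous σ-root)
                         (cong (D.lastExit rootᴰ) (sym v₀≡)))
      ... | no v≢ = sym (trans (cong (D.lastExit rootᴰ) (sym (trans (source-σ y) source-y)))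
                      (proj₂ (toWitness {a? = D.isTreeArc? (σ y)} (subst T (trees (proj₁ y) (proj₂ y)) y-inTree))))
        where
        y : E
        y = C.lastExit rootᶜ v
        source-y : C.source y ≡ v
        source-y = C.source-lastExit rootᶜ v
        y-inTree : T (C.treeArcs y)
        y-inTree = fromWitness (v≢ ∘ trans (sym source-y) , cong (C.lastExit rootᶜ) source-y)
      σ-turn : ∀ x → σ (Turning.turn πᶜ x) ≡ Turning.turn πᴰ (σ x)
      σ-turn = τ-determined _≟ˡ_ C.tour D.tour σ source-σ along (λ _ → refl)
        C.source-turn D.source-turn σ-root σ-lastExit σ-previous
      π-comm : ∀ t h → relabel i ⟨$⟩ʳ (πᶜ t ⟨$⟩ʳ h) ≡ πᴰ t ⟨$⟩ʳ (relabel i ⟨$⟩ʳ h)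
      π-comm t h with u , refl ← FiniteSet.injective⇒surjective Fin._≟_ (λ t → t) (λ eq → eq) nextType-injective t =
        begin
          relabel i ⟨$⟩ʳ (πᶜ t ⟨$⟩ʳ h)  ≡⟨ Perm.inverseʳ (πᴰ t) ⟨
          πᴰ t ⟨$⟩ʳ (πᴰ t ⟨$⟩ˡ (relabel i ⟨$⟩ʳ (πᶜ t ⟨$⟩ʳ h)))
            ≡⟨ cong (πᴰ t ⟨$⟩ʳ_) (,-injectiveʳ (σ-turn (u , πᶜ t ⟨$⟩ʳ h))) ⟨
          πᴰ t ⟨$⟩ʳ (relabel i ⟨$⟩ʳ (πᶜ t ⟨$⟩ˡ (πᶜ t ⟨$⟩ʳ h)))
            ≡⟨ cong (λ h → πᴰ t ⟨$⟩ʳ (relabel i ⟨$⟩ʳ h)) (Perm.inverseˡ (πᶜ t)) ⟩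
          πᴰ t ⟨$⟩ʳ (relabel i ⟨$⟩ʳ h) ∎

  Φ-surjective : Surjective (Setoid._≈_ (coloredCacti n p)) (Setoid._≈_ (treeRootedConstellations n p)) Φ
  Φ-surjective D = TreeTour.cactus D , λ {C} C≈ →
    Setoid.trans (treeRootedConstellations n p) {Φ C} {Φ (TreeTour.cactus D)} {D}
      (Φ-cong {C} {TreeTour.cactus D} C≈) (TreeTour.treeRooted-cactus D)

theorem3p1 : ∀ (k n : ℕ) .{{_ : NonTrivial k}} .{{_ : NonZero n}}
    (p : Fin k → ℕ) → (∀ t → NonZero (p t)) →
    Σ[ Φ ∈ Bijection (coloredCacti n p) (treeRootedConstellations n p) ]
    (∀ (C : ColoredCactus n p) (t : Fin k) (i : Fin (p t)) (j : Fin (p (nextType t))) →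
    ColoredCactus.edgesJoining C t i j ≡ TreeRooted.edgesJoining (Bijection.to Φ C) t i j)
theorem3p1 (2+ k) n p _ =
  record
    { to = Φ
    ; cong = λ {C} {D} → Φ-cong {C = C} {D}
    ; bijective = (λ {C} {D} → Φ-injective {C = C} {D}) , Φ-surjective
    }
  -- `Φ` keeps the hyperedges and takes the colors as labels, so both counts are the same
  -- expression.
  , λ _ _ _ _ → refl
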